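{- Let $\mathcal{D}$ be a $2$-$(v,k,1)$ design (Steiner system) with $b>v$ blocks and replication number $r=\frac{v-1}{k-1}$. Let $\Gamma$ be the graph whose vertices are the points and the blocks of $\mathcal{D}$, where no two points are adjacent, a point and a block are adjacent if and only if they are incident, and two distinct blocks are adjacent if and only if they intersect in one point. Then $\Gamma$ has exactly three distinct $\mathcal{L}$-eigenvalues, the non-trivial (non-zero) ones being $1+\frac{1}{r}$ and $1-\frac{1}{k}+\frac{1}{rk}$.
   Context: All graphs are finite, simple and undirected. $d_u$ denotes the valency (degree) of vertex $u$. The normalized Laplacian of a graph is the matrix $\mathcal{L}=[\ell_{uv}]$ indexed by the vertices with $\ell_{uu}=1$ if $d_u\neq 0$, $\ell_{uv}=-1/\sqrt{d_ud_v}$ if $u$ and $v$ are adjacent, and $\ell_{uv}=0$ otherwise. Its eigenvalues are called the $\mathcal{L}$-eigenvalues of the graph. A $2$-$(v,k,1)$ design ($2\le k<v$) consists of $v$ points and $b$ blocks, each block being a set of $k$ points, such that any two distinct points are in exactly one common block; each point is then in $r=\frac{v-1}{k-1}$ blocks, and any two distinct blocks meet in $0$ or $1$ points. -}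

module Defs where

open import Algebra.Bundles using (CommutativeRing)
import Algebra.Consequences.Setoid
open import Data.Empty using (⊥)
open import Data.Fin.Base using (Fin)
import Data.Fin.Properties as Fin
open import Data.Fin.Subset using (Subset; _∈_; _∩_; ∣_∣)
open import Data.Fin.Subset.Properties using (_∈?_; ∩-comm)
open import Data.Integer.Base as ℤ using (+_; +[1+_]; -[1+_])
import Data.Integer.Properties as ℤ
import Data.Integer.Solver as ℤSolver
open import Data.List.Base using (List; []; _∷_; length; map; filter; allFin)
open import Data.List.Membership.Propositional.Properties
  using (∈-filter⁺; ∈-map⁺; ∈-allFin)
open import Data.List.Relation.Unary.AllPairs using (AllPairs)
open import Data.List.Relation.Unary.Any using (Any; here; there)
open import Data.Nat.Base as ℕ using (ℕ; zero; suc; z≤n; s≤s)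
import Data.Nat.Properties as ℕ
import Data.Nat.Solver as ℕSolver
open import Data.Product.Base using (∃-syntax; Σ-syntax; _×_; _,_)
open import Data.Product using (∃!)
open import Data.Rational.Base as ℚ using (ℚ; mkℚ; 0ℚ; 1ℚ; 1/_; toℚᵘ)
import Data.Rational.Properties as ℚ
import Data.Rational.Solver as ℚSolver
import Data.Rational.Unnormalised.Base as ℚᵘ
import Data.Rational.Unnormalised.Properties as ℚᵘ
open import Data.Sum.Base using (_⊎_; inj₁; inj₂)
open import Function.Base using (_∘_)
open import Function.Bundles using (_↔_; _⇔_; Inverse)
open import Function.Properties.Inverse using (↔⇒↣; ↔-sym)
open import Level using (0ℓ)
open import Relation.Binary.Bundles using (Setoid)
open import Relation.Binary.Definitions using (Decidable; DecidableEquality; Symmetric)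
open import Relation.Binary.PropositionalEquality
  using (_≡_; _≢_; refl; sym; trans; cong; cong₂; subst; subst₂)
open import Relation.Binary.Structures using (IsEquivalence)
open import Relation.Nullary using (¬_; yes; no; contradiction)
open import Relation.Nullary.Decidable using (_×-dec_; ¬?; via-injection)

------------------------------------------------------------------------
-- Real numbers as Cauchy sequences of rationals

-- ∥ p ∥ is the absolute value on ℚ (∣_∣ is kept for cardinalities).
∥_∥ : ℚ → ℚ
∥_∥ = ℚ.∣_∣

record ℝ : Set where
  constructor mkℝ
  field
    seq    : ℕ → ℚ
    cauchy : ∀ ε → 0ℚ ℚ.< ε →
             ∃[ N ] ∀ m n → N ℕ.≤ m → N ℕ.≤ n → ∥ seq m ℚ.- seq n ∥ ℚ.< ε
open ℝ public

infix 4 _≃_ _#_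

record _≃_ (x y : ℝ) : Set where
  constructor mk≃
  field
    close : ∀ ε → 0ℚ ℚ.< ε →
            ∃[ N ] ∀ n → N ℕ.≤ n → ∥ seq x n ℚ.- seq y n ∥ ℚ.< ε
open _≃_ public

-- Apartness, the constructive form of x ≠ y: it is tight, that is,
-- ¬ (x # y) is equivalent to x ≃ y, so classically it is the negation of ≃.
record _#_ (x y : ℝ) : Set where
  constructor mk#
  field
    apart : ∃[ ε ] 0ℚ ℚ.< ε ×
            ∃[ N ] ∀ n → N ℕ.≤ n → ε ℚ.≤ ∥ seq x n ℚ.- seq y n ∥
open _#_ public

module Estimates where
  abstract
    half : ∀ ε → 0ℚ ℚ.< ε → ∃[ δ ] 0ℚ ℚ.< δ × δ ℚ.+ δ ≡ ε
    half ε ε>0 = ε ℚ.* ℚ.½ ,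
      ℚ.positive⁻¹ _ {{ℚ.pos*pos⇒pos ε {{ℚ.positive ε>0}} ℚ.½}} ,
      trans (sym (ℚ.*-distribˡ-+ ε ℚ.½ ℚ.½)) (ℚ.*-identityʳ ε)

    split : ∀ a b c → a ℚ.- c ≡ (a ℚ.- b) ℚ.+ (b ℚ.- c)
    split = solve 3 (λ a b c → a :- c := (a :- b) :+ (b :- c)) refl
      where open ℚSolver.+-*-Solver

    triangle : ∀ {δ ε a c} b → ∥ a ℚ.- b ∥ ℚ.< δ → ∥ b ℚ.- c ∥ ℚ.< ε →
               ∥ a ℚ.- c ∥ ℚ.< δ ℚ.+ ε
    triangle {a = a} {c} b p q = subst (λ z → ∥ z ∥ ℚ.< _) (sym (split a b c))
      (ℚ.≤-<-trans (ℚ.∣p+q∣≤∣p∣+∣q∣ (a ℚ.- b) (b ℚ.- c)) (ℚ.+-mono-< p q))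

    dist-sym : ∀ a b → ∥ a ℚ.- b ∥ ≡ ∥ b ℚ.- a ∥
    dist-sym a b = trans (cong ∥_∥ (flip a b)) (ℚ.∣-p∣≡∣p∣ (b ℚ.- a))
      where
      open ℚSolver.+-*-Solver
      flip : ∀ a b → a ℚ.- b ≡ ℚ.- (b ℚ.- a)
      flip = solve 2 (λ a b → a :- b := :- (b :- a)) refl

    dist-self : ∀ {a b ε} → 0ℚ ℚ.< ε → a ≡ b → ∥ a ℚ.- b ∥ ℚ.< ε
    dist-self {a} ε>0 refl = subst (ℚ._< _) (sym (cong ∥_∥ (ℚ.+-inverseʳ a))) ε>0

    +-close : ∀ {δ ε a b c d} → ∥ a ℚ.- b ∥ ℚ.< δ → ∥ c ℚ.- d ∥ ℚ.< ε →
              ∥ (a ℚ.+ c) ℚ.- (b ℚ.+ d) ∥ ℚ.< δ ℚ.+ ε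
    +-close {a = a} {b} {c} {d} p q = subst (λ z → ∥ z ∥ ℚ.< _) (sym (eq a b c d))
      (ℚ.≤-<-trans (ℚ.∣p+q∣≤∣p∣+∣q∣ (a ℚ.- b) (c ℚ.- d)) (ℚ.+-mono-< p q))
      where
      open ℚSolver.+-*-Solver
      eq : ∀ a b c d → (a ℚ.+ c) ℚ.- (b ℚ.+ d) ≡ (a ℚ.- b) ℚ.+ (c ℚ.- d)
      eq = solve 4 (λ a b c d → (a :+ c) :- (b :+ d) := (a :- b) :+ (c :- d)) refl

    neg-close : ∀ {ε a b} → ∥ a ℚ.- b ∥ ℚ.< ε → ∥ ℚ.- a ℚ.- ℚ.- b ∥ ℚ.< ε
    neg-close {a = a} {b} p = subst (ℚ._< _) (sym (trans (cong ∥_∥ (eq a b)) (ℚ.∣-p∣≡∣p∣ _))) p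
      where
      open ℚSolver.+-*-Solver
      eq : ∀ a b → ℚ.- a ℚ.- ℚ.- b ≡ ℚ.- (a ℚ.- b)
      eq = solve 2 (λ a b → :- a :- :- b := :- (a :- b)) refl

    bounded : ∀ x → ∃[ B ] 0ℚ ℚ.< B × ∃[ N ] ∀ n → N ℕ.≤ n → ∥ seq x n ∥ ℚ.≤ B
    bounded x with cauchy x 1ℚ (ℚ.positive⁻¹ 1ℚ)
    ... | N , close = 1ℚ ℚ.+ ∥ seq x N ∥ ,
      ℚ.<-≤-trans (ℚ.positive⁻¹ 1ℚ)
        (subst (ℚ._≤ 1ℚ ℚ.+ ∥ seq x N ∥) (ℚ.+-identityʳ 1ℚ) (ℚ.+-monoʳ-≤ 1ℚ (ℚ.0≤∣p∣ (seq x N)))) ,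
      N , λ n N≤n →
        subst (λ z → ∥ z ∥ ℚ.≤ _) (sym (eq (seq x n) (seq x N)))
          (ℚ.≤-trans (ℚ.∣p+q∣≤∣p∣+∣q∣ (seq x n ℚ.- seq x N) (seq x N))
            (ℚ.+-monoˡ-≤ ∥ seq x N ∥ (ℚ.<⇒≤ (close n N N≤n ℕ.≤-refl))))
      where
      open ℚSolver.+-*-Solver
      eq : ∀ a b → a ≡ (a ℚ.- b) ℚ.+ b
      eq = solve 2 (λ a b → a := (a :- b) :+ b) refl

    *-close : ∀ {A D} → 0ℚ ℚ.< A → 0ℚ ℚ.< D → ∀ ε → 0ℚ ℚ.< ε →
              ∃[ δ ] 0ℚ ℚ.< δ ×
              (∀ {a b c d} → ∥ a ∥ ℚ.≤ A → ∥ d ∥ ℚ.≤ D →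
               ∥ a ℚ.- b ∥ ℚ.< δ → ∥ c ℚ.- d ∥ ℚ.< δ →
               ∥ a ℚ.* c ℚ.- b ℚ.* d ∥ ℚ.< ε)
    *-close {A} {D} A>0 D>0 ε ε>0 = δ , ℚ.positive⁻¹ δ , main
      where
      instance
        A⁺ : ℚ.Positive A
        A⁺ = ℚ.positive A>0
        D⁺ : ℚ.Positive D
        D⁺ = ℚ.positive D>0
        ε⁺ : ℚ.Positive ε
        ε⁺ = ℚ.positive ε>0
        S⁺ : ℚ.Positive (A ℚ.+ D)
        S⁺ = ℚ.pos+pos⇒pos A D
        S≢0 : ℚ.NonZero (A ℚ.+ D)
        S≢0 = ℚ.pos⇒nonZero (A ℚ.+ D)
        S⁻¹⁺ : ℚ.Positive (1/ (A ℚ.+ D))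
        S⁻¹⁺ = ℚ.1/pos⇒pos (A ℚ.+ D)
      δ : ℚ
      δ = (1/ (A ℚ.+ D)) ℚ.* ε
      instance
        δ⁺ : ℚ.Positive δ
        δ⁺ = ℚ.pos*pos⇒pos (1/ (A ℚ.+ D)) ε
      total : A ℚ.* δ ℚ.+ δ ℚ.* D ≡ ε
      total = trans (eq A D (1/ (A ℚ.+ D)) ε)
        (trans (cong (ℚ._* ε) (ℚ.*-inverseʳ (A ℚ.+ D))) (ℚ.*-identityˡ ε))
        where
        open ℚSolver.+-*-Solver
        eq : ∀ a d s e → a ℚ.* (s ℚ.* e) ℚ.+ (s ℚ.* e) ℚ.* d ≡ ((a ℚ.+ d) ℚ.* s) ℚ.* e
        eq = solve 4 (λ a d s e → a :* (s :* e) :+ (s :* e) :* d := ((a :+ d) :* s) :* e) refl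
      main : ∀ {a b c d} → ∥ a ∥ ℚ.≤ A → ∥ d ∥ ℚ.≤ D →
             ∥ a ℚ.- b ∥ ℚ.< δ → ∥ c ℚ.- d ∥ ℚ.< δ → ∥ a ℚ.* c ℚ.- b ℚ.* d ∥ ℚ.< ε
      main {a} {b} {c} {d} a≤A d≤D ab cd = begin-strict
        ∥ a ℚ.* c ℚ.- b ℚ.* d ∥
          ≡⟨ cong ∥_∥ (eq a b c d) ⟩
        ∥ a ℚ.* (c ℚ.- d) ℚ.+ (a ℚ.- b) ℚ.* d ∥
          ≤⟨ ℚ.∣p+q∣≤∣p∣+∣q∣ (a ℚ.* (c ℚ.- d)) ((a ℚ.- b) ℚ.* d) ⟩
        ∥ a ℚ.* (c ℚ.- d) ∥ ℚ.+ ∥ (a ℚ.- b) ℚ.* d ∥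
          ≡⟨ cong₂ ℚ._+_ (ℚ.∣p*q∣≡∣p∣*∣q∣ a (c ℚ.- d)) (ℚ.∣p*q∣≡∣p∣*∣q∣ (a ℚ.- b) d) ⟩
        ∥ a ∥ ℚ.* ∥ c ℚ.- d ∥ ℚ.+ ∥ a ℚ.- b ∥ ℚ.* ∥ d ∥
          ≤⟨ ℚ.+-mono-≤
               (ℚ.*-monoʳ-≤-nonNeg ∥ c ℚ.- d ∥ {{ℚ.∣-∣-nonNeg (c ℚ.- d)}} a≤A)
               (ℚ.*-monoˡ-≤-nonNeg ∥ a ℚ.- b ∥ {{ℚ.∣-∣-nonNeg (a ℚ.- b)}} d≤D) ⟩
        A ℚ.* ∥ c ℚ.- d ∥ ℚ.+ ∥ a ℚ.- b ∥ ℚ.* D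
          <⟨ ℚ.+-mono-< (ℚ.*-monoʳ-<-pos A cd) (ℚ.*-monoˡ-<-pos D ab) ⟩
        A ℚ.* δ ℚ.+ δ ℚ.* D
          ≡⟨ total ⟩
        ε ∎
        where
        open ℚ.≤-Reasoning
        open ℚSolver.+-*-Solver
        eq : ∀ a b c d → a ℚ.* c ℚ.- b ℚ.* d ≡ a ℚ.* (c ℚ.- d) ℚ.+ (a ℚ.- b) ℚ.* d
        eq = solve 4 (λ a b c d → a :* c :- b :* d := a :* (c :- d) :+ (a :- b) :* d) refl

    ⊔ˡ : ∀ {m n o} → m ℕ.⊔ n ℕ.≤ o → m ℕ.≤ o
    ⊔ˡ {m} {n} = ℕ.≤-trans (ℕ.m≤m⊔n m n)

    ⊔ʳ : ∀ {m n o} → m ℕ.⊔ n ℕ.≤ o → n ℕ.≤ o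
    ⊔ʳ {m} {n} = ℕ.≤-trans (ℕ.m≤n⊔m m n)

  Cauchy : (ℕ → ℚ) → Set
  Cauchy s = ∀ ε → 0ℚ ℚ.< ε →
             ∃[ N ] ∀ m n → N ℕ.≤ m → N ℕ.≤ n → ∥ s m ℚ.- s n ∥ ℚ.< ε

  abstract
    const-cauchy : ∀ q → Cauchy (λ _ → q)
    const-cauchy q ε ε>0 = 0 , λ _ _ _ _ → dist-self {q} ε>0 refl

    +-cauchy : ∀ x y → Cauchy (λ n → seq x n ℚ.+ seq y n)
    +-cauchy x y ε ε>0 with half ε ε>0
    ... | δ , δ>0 , refl with cauchy x δ δ>0 | cauchy y δ δ>0
    ... | M , p | N , q = M ℕ.⊔ N , λ m n a b →
      +-close {a = seq x m} {seq x n} {seq y m} {seq y n} (p m n (⊔ˡ a) (⊔ˡ b)) (q m n (⊔ʳ {M} a) (⊔ʳ {M} b))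

    neg-cauchy : ∀ x → Cauchy (λ n → ℚ.- seq x n)
    neg-cauchy x ε ε>0 with cauchy x ε ε>0
    ... | N , p = N , λ m n a b → neg-close {a = seq x m} {seq x n} (p m n a b)

    *-cauchy : ∀ x y → Cauchy (λ n → seq x n ℚ.* seq y n)
    *-cauchy x y ε ε>0 =
      let A , A>0 , K , ∣x∣≤A = bounded x
          D , D>0 , L , ∣y∣≤D = bounded y
          δ , δ>0 , close     = *-close A>0 D>0 ε ε>0
          M , p               = cauchy x δ δ>0
          N , q               = cauchy y δ δ>0
      in (K ℕ.⊔ L) ℕ.⊔ (M ℕ.⊔ N) , λ m n a b → close
           {seq x m} {seq x n} {seq y m} {seq y n}
           (∣x∣≤A m (⊔ˡ (⊔ˡ {K ℕ.⊔ L} a))) (∣y∣≤D n (⊔ʳ {K} (⊔ˡ {K ℕ.⊔ L} b)))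
           (p m n (⊔ˡ (⊔ʳ {K ℕ.⊔ L} a)) (⊔ˡ (⊔ʳ {K ℕ.⊔ L} b)))
           (q m n (⊔ʳ {M} (⊔ʳ {K ℕ.⊔ L} a)) (⊔ʳ {M} (⊔ʳ {K ℕ.⊔ L} b)))

open Estimates

fromℚ : ℚ → ℝ
fromℚ q = mkℝ (λ _ → q) (const-cauchy q)

0ℝ 1ℝ : ℝ
0ℝ = fromℚ 0ℚ
1ℝ = fromℚ 1ℚ

infixl 6 _+_
infixl 7 _*_
infix  8 -_

-- The operations are opaque only to keep unification from unfolding them.
opaque
  _+_ : ℝ → ℝ → ℝ
  x + y = mkℝ (λ n → seq x n ℚ.+ seq y n) (+-cauchy x y)

  _*_ : ℝ → ℝ → ℝ
  x * y = mkℝ (λ n → seq x n ℚ.* seq y n) (*-cauchy x y)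

  -_ : ℝ → ℝ
  - x = mkℝ (λ n → ℚ.- seq x n) (neg-cauchy x)

abstract
  ≃-pointwise : ∀ {x y} → (∀ n → seq x n ≡ seq y n) → x ≃ y
  ≃-pointwise {x} x≗y = mk≃ λ ε ε>0 → 0 , λ n _ → dist-self {seq x n} ε>0 (x≗y n)

  ≃-sym : ∀ {x y} → x ≃ y → y ≃ x
  ≃-sym {x} {y} x≃y = mk≃ λ ε ε>0 →
    let N , p = close x≃y ε ε>0
    in N , λ n a → subst (ℚ._< ε) (dist-sym (seq x n) (seq y n)) (p n a)

  ≃-trans : ∀ {x y z} → x ≃ y → y ≃ z → x ≃ z
  ≃-trans {x} {y} {z} x≃y y≃z = mk≃ λ ε ε>0 →
    let δ , δ>0 , δ+δ≡ε = half ε ε>0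
        M , p           = close x≃y δ δ>0
        N , q           = close y≃z δ δ>0
    in M ℕ.⊔ N , λ n a → subst (∥ seq x n ℚ.- seq z n ∥ ℚ.<_) δ+δ≡ε
         (triangle {a = seq x n} {seq z n} (seq y n) (p n (⊔ˡ a)) (q n (⊔ʳ {M} a)))

opaque
  unfolding _+_ _*_ -_

  +-cong : ∀ {x x′ y y′} → x ≃ x′ → y ≃ y′ → x + y ≃ x′ + y′
  +-cong {x} {x′} {y} {y′} x≃x′ y≃y′ = mk≃ λ ε ε>0 →
    let δ , δ>0 , δ+δ≡ε = half ε ε>0
        M , p           = close x≃x′ δ δ>0
        N , q           = close y≃y′ δ δ>0
    in M ℕ.⊔ N , λ n a →
         subst (∥ (seq x n ℚ.+ seq y n) ℚ.- (seq x′ n ℚ.+ seq y′ n) ∥ ℚ.<_) δ+δ≡ε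
           (+-close {a = seq x n} {seq x′ n} {seq y n} {seq y′ n} (p n (⊔ˡ a)) (q n (⊔ʳ {M} a)))

  *-cong : ∀ {x x′ y y′} → x ≃ x′ → y ≃ y′ → x * y ≃ x′ * y′
  *-cong {x} {x′} {y} {y′} x≃x′ y≃y′ = mk≃ λ ε ε>0 →
    let A , A>0 , K , ∣x∣≤A  = bounded x
        D , D>0 , L , ∣y′∣≤D = bounded y′
        δ , δ>0 , near       = *-close A>0 D>0 ε ε>0
        M , p                = close x≃x′ δ δ>0
        N , q                = close y≃y′ δ δ>0
    in (K ℕ.⊔ L) ℕ.⊔ (M ℕ.⊔ N) , λ n a → near
         {seq x n} {seq x′ n} {seq y n} {seq y′ n}
         (∣x∣≤A n (⊔ˡ (⊔ˡ {K ℕ.⊔ L} a))) (∣y′∣≤D n (⊔ʳ {K} (⊔ˡ {K ℕ.⊔ L} a)))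
         (p n (⊔ˡ (⊔ʳ {K ℕ.⊔ L} a))) (q n (⊔ʳ {M} (⊔ʳ {K ℕ.⊔ L} a)))

  neg-cong : ∀ {x y} → x ≃ y → - x ≃ - y
  neg-cong {x} {y} x≃y = mk≃ λ ε ε>0 →
    let N , p = close x≃y ε ε>0
    in N , λ n a → neg-close {a = seq x n} {seq y n} (p n a)

  +-assoc : ∀ x y z → (x + y) + z ≃ x + (y + z)
  +-assoc x y z = ≃-pointwise (λ n → ℚ.+-assoc (seq x n) (seq y n) (seq z n))

  +-comm : ∀ x y → x + y ≃ y + x
  +-comm x y = ≃-pointwise (λ n → ℚ.+-comm (seq x n) (seq y n))

  +-identityˡ : ∀ x → 0ℝ + x ≃ x
  +-identityˡ x = ≃-pointwise (λ n → ℚ.+-identityˡ (seq x n))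

  +-inverseˡ : ∀ x → - x + x ≃ 0ℝ
  +-inverseˡ x = ≃-pointwise (λ n → ℚ.+-inverseˡ (seq x n))

  *-assoc : ∀ x y z → (x * y) * z ≃ x * (y * z)
  *-assoc x y z = ≃-pointwise (λ n → ℚ.*-assoc (seq x n) (seq y n) (seq z n))

  *-comm : ∀ x y → x * y ≃ y * x
  *-comm x y = ≃-pointwise (λ n → ℚ.*-comm (seq x n) (seq y n))

  *-identityˡ : ∀ x → 1ℝ * x ≃ x
  *-identityˡ x = ≃-pointwise (λ n → ℚ.*-identityˡ (seq x n))

  *-distribʳ-+ : ∀ x y z → (y + z) * x ≃ y * x + z * x
  *-distribʳ-+ x y z = ≃-pointwise (λ n → ℚ.*-distribʳ-+ (seq x n) (seq y n) (seq z n))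

≃-isEquivalence : IsEquivalence _≃_
≃-isEquivalence = record
  { refl = ≃-pointwise (λ _ → refl) ; sym = ≃-sym ; trans = ≃-trans }

ℝ-setoid : Setoid 0ℓ 0ℓ
ℝ-setoid = record { isEquivalence = ≃-isEquivalence }

private
  module Consequences = Algebra.Consequences.Setoid ℝ-setoid

ℝ-commutativeRing : CommutativeRing 0ℓ 0ℓ
ℝ-commutativeRing = record
  { Carrier = ℝ ; _≈_ = _≃_ ; _+_ = _+_ ; _*_ = _*_ ; -_ = -_ ; 0# = 0ℝ ; 1# = 1ℝ
  ; isCommutativeRing = record
    { isRing = record
      { +-isAbelianGroup = record
        { isGroup = record
          { isMonoid = record
            { isSemigroup = record
              { isMagma = record { isEquivalence = ≃-isEquivalence ; ∙-cong = +-cong }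
              ; assoc = +-assoc
              }
            ; identity = Consequences.comm∧idˡ⇒id +-comm +-identityˡ
            }
          ; inverse = Consequences.comm∧invˡ⇒inv +-comm +-inverseˡ
          ; ⁻¹-cong = neg-cong
          }
        ; comm = +-comm
        }
      ; *-cong = *-cong
      ; *-assoc = *-assoc
      ; *-identity = Consequences.comm∧idˡ⇒id *-comm *-identityˡ
      ; distrib = Consequences.comm∧distrʳ⇒distr +-cong *-comm *-distribʳ-+
      }
    ; *-comm = *-comm
    }
  }

open import Algebra.Properties.Monoid.Sum
  (CommutativeRing.+-monoid ℝ-commutativeRing) public using (sum)

-- The total reciprocal with the junk value 1/0 = 0.  The terms of a
-- sequence representing x # 0 may vanish, but only finitely many of them do.
recip : ℚ → ℚ
recip q with q ℚ.≟ 0ℚ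
... | yes _   = 0ℚ
... | no  q≢0 = (1/ q) {{ℚ.≢-nonZero q≢0}}

abstract
  recip-inverse : ∀ {q} → q ≢ 0ℚ → q ℚ.* recip q ≡ 1ℚ
  recip-inverse {q} q≢0 with q ℚ.≟ 0ℚ
  ... | yes q≡0 = contradiction q≡0 q≢0
  ... | no  q≢0 = ℚ.*-inverseʳ q {{ℚ.≢-nonZero q≢0}}

  away-≢0 : ∀ {e q} → 0ℚ ℚ.< e → e ℚ.≤ ∥ q ℚ.- 0ℚ ∥ → q ≢ 0ℚ
  away-≢0 e>0 e≤ refl = ℚ.<-irrefl refl (ℚ.<-≤-trans e>0 e≤)

  recip-bound : ∀ {e q} → (e>0 : 0ℚ ℚ.< e) → e ℚ.≤ ∥ q ℚ.- 0ℚ ∥ →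
                ∥ recip q ∥ ℚ.≤ recip e
  recip-bound {e} {q} e>0 e≤ = ℚ.*-cancelˡ-≤-pos e {{ℚ.positive e>0}} (begin
    e ℚ.* ∥ recip q ∥
      ≤⟨ ℚ.*-monoʳ-≤-nonNeg ∥ recip q ∥ {{ℚ.∣-∣-nonNeg (recip q)}}
           (subst (λ z → e ℚ.≤ ∥ z ∥) (ℚ.+-identityʳ q) e≤) ⟩
    ∥ q ∥ ℚ.* ∥ recip q ∥
      ≡⟨ sym (ℚ.∣p*q∣≡∣p∣*∣q∣ q (recip q)) ⟩
    ∥ q ℚ.* recip q ∥
      ≡⟨ cong ∥_∥ (recip-inverse {q} (away-≢0 e>0 e≤)) ⟩
    1ℚ
      ≡⟨ sym (recip-inverse {e} (λ e≡0 → ℚ.<⇒≢ e>0 (sym e≡0))) ⟩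
    e ℚ.* recip e ∎)
    where open ℚ.≤-Reasoning

  recip-diff : ∀ {a b} → a ≢ 0ℚ → b ≢ 0ℚ →
               recip a ℚ.- recip b ≡ (b ℚ.- a) ℚ.* (recip a ℚ.* recip b)
  recip-diff {a} {b} a≢0 b≢0 =
    sym (trans (eq a b (recip a) (recip b))
      (trans (cong₂ (λ s t → t ℚ.* recip a ℚ.- s ℚ.* recip b)
               (recip-inverse a≢0) (recip-inverse b≢0))
        (cong₂ ℚ._-_ (ℚ.*-identityˡ (recip a)) (ℚ.*-identityˡ (recip b)))))
    where
    open ℚSolver.+-*-Solver
    eq : ∀ a b s t → (b ℚ.- a) ℚ.* (s ℚ.* t) ≡ (b ℚ.* t) ℚ.* s ℚ.- (a ℚ.* s) ℚ.* t
    eq = solve 4 (λ a b s t → (b :- a) :* (s :* t) := (b :* t) :* s :- (a :* s) :* t) refl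

  recip-cauchy : ∀ x → x # 0ℝ → Cauchy (recip ∘ seq x)
  recip-cauchy x (mk# (e , e>0 , K , away)) ε ε>0
    with cauchy x (ε ℚ.* (e ℚ.* e))
           (ℚ.positive⁻¹ _ {{ℚ.pos*pos⇒pos ε {{ℚ.positive ε>0}} (e ℚ.* e)
             {{ℚ.pos*pos⇒pos e {{ℚ.positive e>0}} e {{ℚ.positive e>0}}}}}})
  ... | N , p = K ℕ.⊔ N , λ m n k l → begin-strict
    ∥ recip (seq x m) ℚ.- recip (seq x n) ∥
      ≡⟨ cong ∥_∥ (recip-diff (away-≢0 {q = seq x m} e>0 (away m (⊔ˡ k)))
                        (away-≢0 {q = seq x n} e>0 (away n (⊔ˡ l)))) ⟩
    ∥ (seq x n ℚ.- seq x m) ℚ.* (recip (seq x m) ℚ.* recip (seq x n)) ∥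
      ≡⟨ trans (ℚ.∣p*q∣≡∣p∣*∣q∣ (seq x n ℚ.- seq x m) _)
           (cong (∥ seq x n ℚ.- seq x m ∥ ℚ.*_)
             (ℚ.∣p*q∣≡∣p∣*∣q∣ (recip (seq x m)) (recip (seq x n)))) ⟩
    ∥ seq x n ℚ.- seq x m ∥ ℚ.* (∥ recip (seq x m) ∥ ℚ.* ∥ recip (seq x n) ∥)
      ≤⟨ ℚ.*-monoˡ-≤-nonNeg ∥ seq x n ℚ.- seq x m ∥ {{ℚ.∣-∣-nonNeg (seq x n ℚ.- seq x m)}}
           (ℚ.≤-trans
             (ℚ.*-monoʳ-≤-nonNeg ∥ recip (seq x n) ∥ {{ℚ.∣-∣-nonNeg (recip (seq x n))}}
               (recip-bound {q = seq x m} e>0 (away m (⊔ˡ k))))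
             (ℚ.*-monoˡ-≤-nonNeg (recip e) {{ℚ.pos⇒nonNeg (recip e) {{E⁺}}}}
               (recip-bound {q = seq x n} e>0 (away n (⊔ˡ l))))) ⟩
    ∥ seq x n ℚ.- seq x m ∥ ℚ.* (recip e ℚ.* recip e)
      <⟨ ℚ.*-monoˡ-<-pos (recip e ℚ.* recip e) {{ℚ.pos*pos⇒pos (recip e) {{E⁺}} (recip e) {{E⁺}}}}
           (p n m (⊔ʳ {K} l) (⊔ʳ {K} k)) ⟩
    (ε ℚ.* (e ℚ.* e)) ℚ.* (recip e ℚ.* recip e)
      ≡⟨ eq ε e (recip e) ⟩
    (ε ℚ.* (e ℚ.* recip e)) ℚ.* (e ℚ.* recip e)
      ≡⟨ cong₂ (λ s t → (ε ℚ.* s) ℚ.* t) e*E e*E ⟩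
    (ε ℚ.* 1ℚ) ℚ.* 1ℚ
      ≡⟨ trans (ℚ.*-identityʳ (ε ℚ.* 1ℚ)) (ℚ.*-identityʳ ε) ⟩
    ε ∎
    where
    open ℚ.≤-Reasoning
    open ℚSolver.+-*-Solver
    eq : ∀ t a b → (t ℚ.* (a ℚ.* a)) ℚ.* (b ℚ.* b) ≡ (t ℚ.* (a ℚ.* b)) ℚ.* (a ℚ.* b)
    eq = solve 3 (λ t a b → (t :* (a :* a)) :* (b :* b) := (t :* (a :* b)) :* (a :* b)) refl
    e≢0 : e ≢ 0ℚ
    e≢0 e≡0 = ℚ.<⇒≢ e>0 (sym e≡0)
    e*E : e ℚ.* recip e ≡ 1ℚ
    e*E = recip-inverse e≢0
    E⁺ : ℚ.Positive (recip e)
    E⁺ with e ℚ.≟ 0ℚ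
    ... | yes e≡0 = contradiction e≡0 e≢0
    ... | no  _   = ℚ.1/pos⇒pos e {{ℚ.positive e>0}}

opaque
  inverse : ∀ x → x # 0ℝ → ℝ
  inverse x x#0 = mkℝ (recip ∘ seq x) (recip-cauchy x x#0)

opaque
  unfolding _*_ inverse

  *-inverseʳ : ∀ x (x#0 : x # 0ℝ) → x * inverse x x#0 ≃ 1ℝ
  *-inverseʳ x (mk# (e , e>0 , K , away)) = mk≃ λ ε ε>0 →
    K , λ n a → dist-self {seq x n ℚ.* recip (seq x n)} ε>0
      (recip-inverse {seq x n} (away-≢0 {q = seq x n} e>0 (away n a)))

------------------------------------------------------------------------
-- Square roots of natural numbers

-- ⌊√ n ⌋
isqrt : ℕ → ℕ
isqrt zero    = 0
isqrt (suc n) with suc (isqrt n) ℕ.* suc (isqrt n) ℕ.≤? suc n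
... | yes _ = suc (isqrt n)
... | no  _ = isqrt n

abstract
  isqrt-lower : ∀ n → isqrt n ℕ.* isqrt n ℕ.≤ n
  isqrt-lower zero    = z≤n
  isqrt-lower (suc n) with suc (isqrt n) ℕ.* suc (isqrt n) ℕ.≤? suc n
  ... | yes p = p
  ... | no  _ = ℕ.m≤n⇒m≤1+n (isqrt-lower n)

  isqrt-upper : ∀ n → n ℕ.< suc (isqrt n) ℕ.* suc (isqrt n)
  isqrt-upper zero    = s≤s z≤n
  isqrt-upper (suc n) with suc (isqrt n) ℕ.* suc (isqrt n) ℕ.≤? suc n
  ... | no  p = ℕ.≰⇒> p
  ... | yes _ = ℕ.≤-<-trans (isqrt-upper n)
    (ℕ.*-mono-< (ℕ.n<1+n (suc (isqrt n))) (ℕ.n<1+n (suc (isqrt n))))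

√-approx : ℕ → ℕ → ℚ
√-approx n m = + isqrt (n ℕ.* (suc m ℕ.* suc m)) ℚ./ suc m

abstract
  /-≤ : ∀ {a c} m n → a ℕ.* suc n ℕ.≤ c ℕ.* suc m → + a ℚ./ suc m ℚ.≤ + c ℚ./ suc n
  /-≤ {a} {c} m n p = ℚ.toℚᵘ-cancel-≤
    (ℚᵘ.≤-respˡ-≃ (ℚᵘ.≃-sym (ℚ.toℚᵘ-fromℚᵘ (ℚᵘ.mkℚᵘ (+ a) m)))
      (ℚᵘ.≤-respʳ-≃ (ℚᵘ.≃-sym (ℚ.toℚᵘ-fromℚᵘ (ℚᵘ.mkℚᵘ (+ c) n)))
        (ℚᵘ.*≤* (subst₂ ℤ._≤_ (ℤ.pos-* a (suc n)) (ℤ.pos-* c (suc m)) (ℤ.+≤+ p)))))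

  /-+ : ∀ a b m → + a ℚ./ suc m ℚ.+ + b ℚ./ suc m ≡ + (a ℕ.+ b) ℚ./ suc m
  /-+ a b m = ℚ.toℚᵘ-injective
    (ℚᵘ.≃-trans (ℚ.toℚᵘ-homo-+ (+ a ℚ./ suc m) (+ b ℚ./ suc m))
      (ℚᵘ.≃-trans (ℚᵘ.+-cong (ℚ.toℚᵘ-fromℚᵘ (ℚᵘ.mkℚᵘ (+ a) m)) (ℚ.toℚᵘ-fromℚᵘ (ℚᵘ.mkℚᵘ (+ b) m)))
        (ℚᵘ.≃-trans (ℚᵘ.*≡* (eq (+ a) (+ b) (+ suc m)))
          (ℚᵘ.≃-sym (ℚ.toℚᵘ-fromℚᵘ (ℚᵘ.mkℚᵘ (+ (a ℕ.+ b)) m))))))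
    where
    open ℤSolver.+-*-Solver
    eq : ∀ a b m → (a ℤ.* m ℤ.+ b ℤ.* m) ℤ.* m ≡ (a ℤ.+ b) ℤ.* (m ℤ.* m)
    eq = solve 3 (λ a b m → (a :* m :+ b :* m) :* m := (a :+ b) :* (m :* m)) refl

  /-* : ∀ a b m n → (+ a ℚ./ suc m) ℚ.* (+ b ℚ./ suc n) ≡ + (a ℕ.* b) ℚ./ (suc m ℕ.* suc n)
  /-* a b m n = ℚ.toℚᵘ-injective
    (ℚᵘ.≃-trans (ℚ.toℚᵘ-homo-* (+ a ℚ./ suc m) (+ b ℚ./ suc n))
      (ℚᵘ.≃-trans (ℚᵘ.*-cong (ℚ.toℚᵘ-fromℚᵘ (ℚᵘ.mkℚᵘ (+ a) m)) (ℚ.toℚᵘ-fromℚᵘ (ℚᵘ.mkℚᵘ (+ b) n)))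
        (ℚᵘ.≃-trans (ℚᵘ.≃-reflexive (cong (λ z → ℚᵘ.mkℚᵘ z (n ℕ.+ m ℕ.* suc n)) (sym (ℤ.pos-* a b))))
          (ℚᵘ.≃-sym (ℚ.toℚᵘ-fromℚᵘ (ℚᵘ.mkℚᵘ (+ (a ℕ.* b)) (n ℕ.+ m ℕ.* suc n)))))))

  archimedean : ∀ c ε → 0ℚ ℚ.< ε → ∃[ K ] ∀ n → K ℕ.≤ n → + c ℚ./ suc n ℚ.< ε
  archimedean c (mkℚ -[1+ _ ] _ _) (ℚ.*<* ())
  archimedean c (mkℚ (+ 0)    _ _) (ℚ.*<* (ℤ.+<+ ()))
  archimedean c (mkℚ +[1+ p ] d _) _ = c ℕ.* suc d , λ n K≤n → ℚ.toℚᵘ-cancel-<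
    (ℚᵘ.<-respˡ-≃ (ℚᵘ.≃-sym (ℚ.toℚᵘ-fromℚᵘ (ℚᵘ.mkℚᵘ (+ c) n)))
      (ℚᵘ.*<* (subst₂ ℤ._<_ (ℤ.pos-* c (suc d)) (ℤ.pos-* (suc p) (suc n))
        (ℤ.+<+ (ℕ.≤-trans (s≤s K≤n) (ℕ.m≤m+n (suc n) (p ℕ.* suc n)))))))

  sq-cancel-< : ∀ {a b} → a ℕ.* a ℕ.< b ℕ.* b → a ℕ.< b
  sq-cancel-< {a} {b} p with a ℕ.<? b
  ... | yes a<b = a<b
  ... | no  a≮b = contradiction p (ℕ.≤⇒≯ (ℕ.*-mono-≤ (ℕ.≮⇒≥ a≮b) (ℕ.≮⇒≥ a≮b)))

  cross-< : ∀ n a c M K → .{{ℕ.NonZero M}} → a ℕ.* a ℕ.≤ n ℕ.* (M ℕ.* M) →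
            n ℕ.* (K ℕ.* K) ℕ.< c ℕ.* c → a ℕ.* K ℕ.< c ℕ.* M
  cross-< n a c M K lower upper = sq-cancel-< (begin-strict
    (a ℕ.* K) ℕ.* (a ℕ.* K)             ≡⟨ eq₁ a K ⟩
    (a ℕ.* a) ℕ.* (K ℕ.* K)             ≤⟨ ℕ.*-monoˡ-≤ (K ℕ.* K) lower ⟩
    (n ℕ.* (M ℕ.* M)) ℕ.* (K ℕ.* K)     ≡⟨ eq₂ n M K ⟩
    (n ℕ.* (K ℕ.* K)) ℕ.* (M ℕ.* M)     <⟨ ℕ.*-monoˡ-< (M ℕ.* M) {{ℕ.m*n≢0 M M}} upper ⟩
    (c ℕ.* c) ℕ.* (M ℕ.* M)             ≡⟨ sym (eq₁ c M) ⟩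
    (c ℕ.* M) ℕ.* (c ℕ.* M)             ∎)
    where
    open ℕ.≤-Reasoning
    open ℕSolver.+-*-Solver
    eq₁ : ∀ a b → (a ℕ.* b) ℕ.* (a ℕ.* b) ≡ (a ℕ.* a) ℕ.* (b ℕ.* b)
    eq₁ = solve 2 (λ a b → (a :* b) :* (a :* b) := (a :* a) :* (b :* b)) refl
    eq₂ : ∀ n a b → (n ℕ.* (a ℕ.* a)) ℕ.* (b ℕ.* b) ≡ (n ℕ.* (b ℕ.* b)) ℕ.* (a ℕ.* a)
    eq₂ = solve 3 (λ n a b → (n :* (a :* a)) :* (b :* b) := (n :* (b :* b)) :* (a :* a)) refl

  √-approx-≤ : ∀ n m k → √-approx n m ℚ.≤ √-approx n k ℚ.+ + 1 ℚ./ suc k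
  √-approx-≤ n m k =
    let a = isqrt (n ℕ.* (suc m ℕ.* suc m))
        c = isqrt (n ℕ.* (suc k ℕ.* suc k))
    in subst (√-approx n m ℚ.≤_) (sym (/-+ c 1 k))
    (/-≤ {a} {c ℕ.+ 1} m k
      (subst (λ z → a ℕ.* suc k ℕ.≤ z ℕ.* suc m) (ℕ.+-comm 1 c)
        (ℕ.<⇒≤ (cross-< n a (suc c) (suc m) (suc k)
          (isqrt-lower (n ℕ.* (suc m ℕ.* suc m)))
          (isqrt-upper (n ℕ.* (suc k ℕ.* suc k)))))))

  ≤+⇒-≤ : ∀ {a b c} → a ℚ.≤ b ℚ.+ c → a ℚ.- b ℚ.≤ c
  ≤+⇒-≤ {a} {b} {c} p = subst (a ℚ.- b ℚ.≤_) (eq b c) (ℚ.+-monoˡ-≤ (ℚ.- b) p)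
    where
    open ℚSolver.+-*-Solver
    eq : ∀ b c → (b ℚ.+ c) ℚ.- b ≡ c
    eq = solve 2 (λ b c → (b :+ c) :- b := c) refl

  ∥∥-< : ∀ {a b ε} → a ℚ.- b ℚ.< ε → b ℚ.- a ℚ.< ε → ∥ a ℚ.- b ∥ ℚ.< ε
  ∥∥-< {a} {b} {ε} p q with ℚ.∣p∣≡p∨∣p∣≡-p (a ℚ.- b)
  ... | inj₁ e = subst (ℚ._< ε) (sym e) p
  ... | inj₂ e = subst (ℚ._< ε) (sym (trans e (eq a b))) q
    where
    open ℚSolver.+-*-Solver
    eq : ∀ a b → ℚ.- (a ℚ.- b) ≡ b ℚ.- a
    eq = solve 2 (λ a b → :- (a :- b) := b :- a) refl

  √-cauchy : ∀ n → Cauchy (√-approx n)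
  √-cauchy n ε ε>0 =
    let K , small = archimedean 1 ε ε>0
    in K , λ m k K≤m K≤k → ∥∥-< {√-approx n m} {√-approx n k}
    (ℚ.≤-<-trans (≤+⇒-≤ {√-approx n m} {√-approx n k} (√-approx-≤ n m k)) (small k K≤k))
    (ℚ.≤-<-trans (≤+⇒-≤ {√-approx n k} {√-approx n m} (√-approx-≤ n k m)) (small m K≤m))

  ≤-square : ∀ n M a → a ℕ.* a ℕ.≤ n ℕ.* (M ℕ.* M) → a ℕ.≤ n ℕ.* M
  ≤-square n M a lower = ℕ.≮⇒≥ (λ nM<a → ℕ.<⇒≱ (ℕ.≤-<-trans (lem n) (ℕ.*-mono-< nM<a nM<a)) lower)
    where
    open ℕSolver.+-*-Solver
    eq : ∀ n m → (n ℕ.* m) ℕ.* (n ℕ.* m) ≡ n ℕ.* (n ℕ.* (m ℕ.* m))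
    eq = solve 2 (λ n m → (n :* m) :* (n :* m) := n :* (n :* (m :* m))) refl
    lem : ∀ n → n ℕ.* (M ℕ.* M) ℕ.≤ (n ℕ.* M) ℕ.* (n ℕ.* M)
    lem zero      = z≤n
    lem n@(suc _) = subst (n ℕ.* (M ℕ.* M) ℕ.≤_) (sym (eq n M)) (ℕ.m≤n*m (n ℕ.* (M ℕ.* M)) n)

  square-upper : ∀ n M a → a ℕ.* a ℕ.≤ n ℕ.* (M ℕ.* M) → n ℕ.* (M ℕ.* M) ℕ.< suc a ℕ.* suc a →
                 n ℕ.* (M ℕ.* M) ℕ.≤ (a ℕ.* a ℕ.+ (2 ℕ.* n) ℕ.* M) ℕ.* 1
  square-upper n M a lower upper = begin
    n ℕ.* (M ℕ.* M)
      ≤⟨ ℕ.≤-pred upper ⟩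
    a ℕ.+ a ℕ.* suc a
      ≡⟨ eq a ⟩
    a ℕ.* a ℕ.+ 2 ℕ.* a
      ≤⟨ ℕ.+-monoʳ-≤ (a ℕ.* a) (ℕ.*-monoʳ-≤ 2 (≤-square n M a lower)) ⟩
    a ℕ.* a ℕ.+ 2 ℕ.* (n ℕ.* M)
      ≡⟨ eq′ a n M ⟩
    (a ℕ.* a ℕ.+ (2 ℕ.* n) ℕ.* M) ℕ.* 1 ∎
    where
    open ℕ.≤-Reasoning
    open ℕSolver.+-*-Solver
    eq : ∀ a → a ℕ.+ a ℕ.* suc a ≡ a ℕ.* a ℕ.+ 2 ℕ.* a
    eq = solve 1 (λ a → a :+ a :* (con 1 :+ a) := a :* a :+ con 2 :* a) refl
    eq′ : ∀ a n m → a ℕ.* a ℕ.+ 2 ℕ.* (n ℕ.* m) ≡ (a ℕ.* a ℕ.+ (2 ℕ.* n) ℕ.* m) ℕ.* 1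
    eq′ = solve 3 (λ a n m → a :* a :+ con 2 :* (n :* m) := (a :* a :+ (con 2 :* n) :* m) :* con 1) refl

  /-scale : ∀ c m → + c ℚ./ suc m ≡ + (c ℕ.* suc m) ℚ./ (suc m ℕ.* suc m)
  /-scale c m = trans
    (sym (trans (cong ((+ c ℚ./ suc m) ℚ.*_) self) (ℚ.*-identityʳ (+ c ℚ./ suc m))))
    (/-* c (suc m) m m)
    where
    self : + suc m ℚ./ suc m ≡ 1ℚ
    self = ℚ.≤-antisym
      (/-≤ {suc m} {1} m 0 (ℕ.≤-reflexive (ℕ.*-comm (suc m) 1)))
      (/-≤ {1} {suc m} 0 m (ℕ.≤-reflexive (ℕ.*-comm 1 (suc m))))

  √-approx²-≤ : ∀ n m → √-approx n m ℚ.* √-approx n m ℚ.≤ + n ℚ./ 1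
  √-approx²-≤ n m =
    let a = isqrt (n ℕ.* (suc m ℕ.* suc m))
    in subst (ℚ._≤ + n ℚ./ 1) (sym (/-* a a m m))
      (/-≤ {a ℕ.* a} {n} (m ℕ.+ m ℕ.* suc m) 0
        (subst (ℕ._≤ n ℕ.* (suc m ℕ.* suc m)) (sym (ℕ.*-identityʳ (a ℕ.* a)))
          (isqrt-lower (n ℕ.* (suc m ℕ.* suc m)))))

  √-approx²-≥ : ∀ n m → + n ℚ./ 1 ℚ.≤ √-approx n m ℚ.* √-approx n m ℚ.+ + (2 ℕ.* n) ℚ./ suc m
  √-approx²-≥ n m =
    let a = isqrt (n ℕ.* (suc m ℕ.* suc m))
    in subst (+ n ℚ./ 1 ℚ.≤_)
      (sym (trans (cong₂ ℚ._+_ (/-* a a m m) (/-scale (2 ℕ.* n) m))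
        (/-+ (a ℕ.* a) ((2 ℕ.* n) ℕ.* suc m) (m ℕ.+ m ℕ.* suc m))))
      (/-≤ {n} {a ℕ.* a ℕ.+ (2 ℕ.* n) ℕ.* suc m} 0 (m ℕ.+ m ℕ.* suc m)
        (square-upper n (suc m) a (isqrt-lower (n ℕ.* (suc m ℕ.* suc m)))
          (isqrt-upper (n ℕ.* (suc m ℕ.* suc m)))))

  √-approx-≥1 : ∀ n → .{{ℕ.NonZero n}} → ∀ m → 1ℚ ℚ.≤ √-approx n m
  √-approx-≥1 n m = /-≤ {1} {isqrt (n ℕ.* (suc m ℕ.* suc m))} 0 m
    (subst₂ ℕ._≤_ (sym (ℕ.*-identityˡ (suc m))) (sym (ℕ.*-identityʳ (isqrt (n ℕ.* (suc m ℕ.* suc m)))))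
      (ℕ.≤-pred (sq-cancel-< (ℕ.≤-<-trans (ℕ.m≤n*m (suc m ℕ.* suc m) n)
        (isqrt-upper (n ℕ.* (suc m ℕ.* suc m)))))))

opaque
  √ : ℕ → ℝ
  √ n = mkℝ (√-approx n) (√-cauchy n)

opaque
  unfolding _*_ √

  √-nonNeg : ∀ n m → 0ℚ ℚ.≤ seq (√ n) m
  √-nonNeg n m = ℚ.nonNegative⁻¹ _
    {{ℚ.normalize-nonNeg (isqrt (n ℕ.* (suc m ℕ.* suc m))) (suc m)}}

  √-square : ∀ n → √ n * √ n ≃ fromℚ (+ n ℚ./ 1)
  √-square n = mk≃ λ ε ε>0 →
    let K , small = archimedean (2 ℕ.* n) ε ε>0
        n′   = + n ℚ./ 1
        sq m = √-approx n m ℚ.* √-approx n m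
    in K , λ m K≤m → ∥∥-< {sq m} {n′}
         (ℚ.≤-<-trans (≤+⇒-≤ {sq m} {n′} {0ℚ}
           (subst (sq m ℚ.≤_) (sym (ℚ.+-identityʳ n′)) (√-approx²-≤ n m))) ε>0)
         (ℚ.≤-<-trans (≤+⇒-≤ {n′} {sq m} {+ (2 ℕ.* n) ℚ./ suc m} (√-approx²-≥ n m)) (small m K≤m))

  √#0 : ∀ n → .{{ℕ.NonZero n}} → √ n # 0ℝ
  √#0 n = mk# (1ℚ , ℚ.positive⁻¹ 1ℚ , 0 , λ m _ →
    subst (1ℚ ℚ.≤_)
      (sym (trans (cong ∥_∥ (ℚ.+-identityʳ (√-approx n m))) (ℚ.0≤p⇒∣p∣≡p (√-nonNeg n m))))
      (√-approx-≥1 n m))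

1/√ : (n : ℕ) → .{{ℕ.NonZero n}} → ℝ
1/√ n = inverse (√ n) (√#0 n)

------------------------------------------------------------------------
-- Graphs and the normalized Laplacian

record Graph : Set₁ where
  field
    Vertex      : Set
    order       : ℕ
    enumeration : Fin order ↔ Vertex
    Adj         : Vertex → Vertex → Set
    adj?        : Decidable Adj
    adj-sym     : Symmetric Adj
    adj-irrefl  : ∀ {u} → ¬ Adj u u

  vertices : List Vertex
  vertices = map (Inverse.to enumeration) (allFin order)

  infix 4 _≟_
  _≟_ : DecidableEquality Vertex
  _≟_ = via-injection (↔⇒↣ (↔-sym enumeration)) Fin._≟_

  degree : Vertex → ℕ
  degree u = length (filter (adj? u) vertices)

  ∑ : (Vertex → ℝ) → ℝ
  ∑ f = sum (f ∘ Inverse.to enumeration)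

  adj⇒degree≢0 : ∀ {u w} → Adj u w → ℕ.NonZero (degree u)
  adj⇒degree≢0 {u} {w} uw = nonEmpty (∈-filter⁺ (adj? u) w∈ uw)
    where
    open import Data.List.Membership.Propositional using () renaming (_∈_ to _∈ₗ_)
    w∈ : w ∈ₗ vertices
    w∈ = subst (_∈ₗ vertices) (Inverse.strictlyInverseˡ enumeration w)
           (∈-map⁺ (Inverse.to enumeration) (∈-allFin (Inverse.from enumeration w)))
    nonEmpty : ∀ {xs} → w ∈ₗ xs → ℕ.NonZero (length xs)
    nonEmpty (here _)  = _
    nonEmpty (there _) = _

  normalizedLaplacian : Vertex → Vertex → ℝ
  normalizedLaplacian u w with u ≟ w | adj? u w
  ... | yes _ | _ with degree u
  ...   | zero  = 0ℝ
  ...   | suc _ = 1ℝ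
  normalizedLaplacian u w | no _ | yes uw =
    - 1/√ (degree u ℕ.* degree w)
        {{ℕ.m*n≢0 _ _ {{adj⇒degree≢0 uw}} {{adj⇒degree≢0 (adj-sym uw)}}}}
  normalizedLaplacian u w | no _ | no _ = 0ℝ

  IsLEigenvalue : ℝ → Set
  IsLEigenvalue θ =
    Σ[ x ∈ (Vertex → ℝ) ]
      (∃[ u ] x u # 0ℝ) ×
      (∀ u → ∑ (λ w → normalizedLaplacian u w * x w) ≃ θ * x u)

  -- The ℒ-eigenvalues are exactly the members of the list, and these are
  -- pairwise distinct; the number of distinct ones is the length of the list.
  DistinctLEigenvaluesAre : List ℝ → Set
  DistinctLEigenvaluesAre θs =
    AllPairs _#_ θs × ∀ θ → IsLEigenvalue θ ⇔ Any (θ ≃_) θs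

------------------------------------------------------------------------
-- 2-(v,k,1) designs

-- Blocks are indexed by Fin b; distinct indices give distinct point sets,
-- since 2 ≤ k and two points lie in the block of only one index.
record Design (v k b : ℕ) : Set where
  field
    2≤k         : 2 ℕ.≤ k
    k<v         : k ℕ.< v
    block       : Fin b → Subset v
    block-size  : ∀ j → ∣ block j ∣ ≡ k
    joint-block : ∀ p q → p ≢ q → ∃! _≡_ (λ j → p ∈ block j × q ∈ block j)

module _ {v k b : ℕ} (D : Design v k b) where
  open Design D

  ΓAdj : Fin v ⊎ Fin b → Fin v ⊎ Fin b → Set
  ΓAdj (inj₁ p) (inj₁ q) = ⊥
  ΓAdj (inj₁ p) (inj₂ j) = p ∈ block j
  ΓAdj (inj₂ i) (inj₁ q) = q ∈ block i
  ΓAdj (inj₂ i) (inj₂ j) = i ≢ j × ∣ block i ∩ block j ∣ ≡ 1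

  ΓAdj? : Decidable ΓAdj
  ΓAdj? (inj₁ p) (inj₁ q) = no (λ ())
  ΓAdj? (inj₁ p) (inj₂ j) = p ∈? block j
  ΓAdj? (inj₂ i) (inj₁ q) = q ∈? block i
  ΓAdj? (inj₂ i) (inj₂ j) = ¬? (i Fin.≟ j) ×-dec (∣ block i ∩ block j ∣ ℕ.≟ 1)

  ΓAdj-sym : Symmetric ΓAdj
  ΓAdj-sym {inj₁ p} {inj₂ j} p∈j = p∈j
  ΓAdj-sym {inj₂ i} {inj₁ q} q∈i = q∈i
  ΓAdj-sym {inj₂ i} {inj₂ j} (i≢j , meet) =
    i≢j ∘ sym , trans (cong ∣_∣ (∩-comm (block j) (block i))) meet

  ΓAdj-irrefl : ∀ {u} → ¬ ΓAdj u u
  ΓAdj-irrefl {inj₁ p} ()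
  ΓAdj-irrefl {inj₂ i} (i≢i , _) = i≢i refl

  Γ : Graph
  Γ = record
    { Vertex      = Fin v ⊎ Fin b
    ; order       = v ℕ.+ b
    ; enumeration = Fin.+↔⊎
    ; Adj         = ΓAdj
    ; adj?        = ΓAdj?
    ; adj-sym     = λ {u} {w} → ΓAdj-sym {u} {w}
    ; adj-irrefl  = λ {u} → ΓAdj-irrefl {u}
    }

  private instance
    k-1≢0 : ℕ.NonZero (k ℕ.∸ 1)
    k-1≢0 = ℕ.>-nonZero (ℕ.m<n⇒0<n∸m 2≤k)

    v-1≢0 : ℕ.NonZero (v ℕ.∸ 1)
    v-1≢0 = ℕ.>-nonZero (ℕ.m<n⇒0<n∸m (ℕ.<-trans 2≤k k<v))

    k≢0 : ℕ.NonZero k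
    k≢0 = ℕ.>-nonZero (ℕ.<-trans (s≤s z≤n) 2≤k)

  -- r = (v-1)/(k-1), taken in ℚ so that no divisibility is presupposed.
  replication : ℚ
  replication = + (v ℕ.∸ 1) ℚ./ (k ℕ.∸ 1)

  private
    r = replication
    k′ = + k ℚ./ 1

    r⁺ : ℚ.Positive r
    r⁺ = ℚ.normalize-pos (v ℕ.∸ 1) (k ℕ.∸ 1)

    k⁺ : ℚ.Positive k′
    k⁺ = ℚ.normalize-pos k 1

    r≢0 : ℚ.NonZero r
    r≢0 = ℚ.pos⇒nonZero r {{r⁺}}

    k′≢0 : ℚ.NonZero k′
    k′≢0 = ℚ.pos⇒nonZero k′ {{k⁺}}

    rk≢0 : ℚ.NonZero (r ℚ.* k′)
    rk≢0 = ℚ.pos⇒nonZero (r ℚ.* k′) {{ℚ.pos*pos⇒pos r {{r⁺}} k′ {{k⁺}}}}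

  1+1/r : ℚ
  1+1/r = 1ℚ ℚ.+ (1/ r) {{r≢0}}

  1-1/k+1/rk : ℚ
  1-1/k+1/rk = 1ℚ ℚ.- (1/ k′) {{k′≢0}} ℚ.+ (1/ (r ℚ.* k′)) {{rk≢0}}

{-# OPTIONS --safe #-}

-- Let N be the v × b incidence matrix and C = [I , e N] with e = 1/√k.  As
-- N Nᵀ = (r - 1) I + J and Nᵀ N = k I + A, where A is the adjacency matrix of the
-- block graph, points have degree r, blocks have degree k r, and r ℒ = (1 + r) I - Cᵀ C.
-- Now C Cᵀ = I + ((r - 1) I + J) / k has the eigenvalues 1 + r, on the constant
-- vectors, and (k + r - 1) / k, on the vectors of sum 0, while Cᵀ C also has the
-- eigenvalue 0.  These correspond to 0, 1 - 1/k + 1/(r k) and 1 + 1/r.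
-- Conversely, (θ - 0) (θ - θ₁) (θ - θ₂) x u ≃ 0 for an eigenvector x with eigenvalue
-- θ; cotransitivity of apartness tells which two of the factors are invertible.
module Submission where

open import Defs
open import Algebra.Bundles using (CommutativeMonoid; CommutativeRing)
import Algebra.Properties.CommutativeMonoid.Sum as MonoidSum
import Algebra.Properties.Group as GroupProperties
import Algebra.Properties.Semiring.Sum as SemiringSum
import Algebra.Solver.Ring
open import Algebra.Solver.Ring.AlmostCommutativeRing
  using (AlmostCommutativeRing; fromCommutativeRing; _-Raw-AlmostCommutative⟶_; Induced-equivalence)
open import Data.Bool.Base using (if_then_else_)
open import Data.Fin.Base using (Fin; zero; suc; splitAt; punchIn; fromℕ<)
import Data.Fin.Properties as Fin
open import Data.Fin.Subset using (Subset; _∈_; _∩_; ∣_∣; ⁅_⁆; inside; outside)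
open import Data.Fin.Subset.Properties
  using (_∈?_; nonempty?; p⊆q⇒∣p∣≤∣q∣; ∣⁅x⁆∣≡1; x∈⁅x⁆; x∈p∩q⁺; x∈p∩q⁻; Empty-unique; ∣⊥∣≡0)
open import Data.Integer.Base using (+_)
import Data.Integer.Properties as ℤ
open import Data.List.Base using ([]; _∷_)
import Data.List.Base as List
import Data.List.Properties as List
open import Data.List.Relation.Unary.All using ([]; _∷_)
open import Data.List.Relation.Unary.AllPairs using ([]; _∷_)
open import Data.List.Relation.Unary.Any using (Any; here; there)
import Data.Maybe.Base as Maybe
open import Data.Nat.Base using (ℕ; _<_)
open import Data.Nat.Base as ℕ using (zero; suc)
import Data.Nat.Properties as ℕ
import Data.Nat.Solver as ℕSolver
open import Data.Product.Base using (_,_; proj₁; proj₂)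
open import Data.Rational.Base as ℚ using (ℚ; 0ℚ; 1ℚ)
import Data.Rational.Properties as ℚ
import Data.Rational.Solver as ℚSolver
import Data.Rational.Unnormalised.Base as ℚᵘ
import Data.Rational.Unnormalised.Properties as ℚᵘ
open import Data.Sum.Base as Sum using (_⊎_; inj₁; inj₂)
open import Data.Vec.Base using ([]; _∷_)
open import Function.Base using (_∘_; id)
open import Function.Bundles using (Inverse; mk⇔)
open import Relation.Binary.Definitions using (WeaklyDecidable)
import Relation.Binary.Reasoning.Setoid as SetoidReasoning
open import Relation.Binary.PropositionalEquality as ≡
  using (_≡_; _≢_; cong; cong₂; subst; subst₂)
open import Relation.Nullary using (¬_; Dec; yes; no; contradiction)
open import Relation.Nullary.Decidable using (does; dec⇒maybe)
open import Relation.Unary using (Pred; Decidable)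

-- Finite sums

module FiniteSum {a ℓ} (M : CommutativeMonoid a ℓ) where
  open CommutativeMonoid M
  open MonoidSum M renaming (sum to ∑ᶠ)

  sum-single : ∀ {n} (f : Fin n → Carrier) i → (∀ j → j ≢ i → f j ≈ ε) → ∑ᶠ f ≈ f i
  sum-single {suc n} f i vanish = begin
    ∑ᶠ f                            ≈⟨ sum-remove f ⟩
    f i ∙ ∑ᶠ (f ∘ punchIn i)        ≈⟨ ∙-congˡ (sum-cong-≋ {n} (λ j → vanish (punchIn i j) (Fin.punchInᵢ≢i i j))) ⟩
    f i ∙ ∑ᶠ {n} (λ _ → ε)         ≈⟨ ∙-congˡ (sum-replicate-zero n) ⟩
    f i ∙ ε                         ≈⟨ identityʳ (f i) ⟩
    f i                             ∎
    where open SetoidReasoning setoid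

  -- The vertices of Γ are enumerated through `splitAt`, so this separates a sum over them into
  -- points and blocks.
  sum-splitAt : ∀ m {n} (f : Fin m ⊎ Fin n → Carrier) →
                ∑ᶠ (f ∘ splitAt m) ≈ ∑ᶠ (f ∘ inj₁) ∙ ∑ᶠ (f ∘ inj₂)
  sum-splitAt zero    f = sym (identityˡ _)
  sum-splitAt (suc m) f =
    trans (∙-congˡ (sum-splitAt m (f ∘ Sum.map suc id))) (sym (assoc _ _ _))

module ℕΣ = SemiringSum ℕ.+-*-semiring
module ℝR = CommutativeRing ℝ-commutativeRing
module ℝΣ = SemiringSum ℝR.semiring

open FiniteSum ℕ.+-0-commutativeMonoid using ()
  renaming (sum-single to ℕ-sum-single; sum-splitAt to ℕ-sum-splitAt)
open FiniteSum ℝR.+-commutativeMonoid using (sum-single; sum-splitAt)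

-- Real numbers

module ≃-Reasoning = SetoidReasoning ℝ-setoid

≃-refl : ∀ {x} → x ≃ x
≃-refl = ℝR.refl

opaque
  unfolding _+_ _*_ -_

  fromℚ-+ : ∀ p q → fromℚ (p ℚ.+ q) ≃ fromℚ p + fromℚ q
  fromℚ-+ p q = ≃-pointwise (λ _ → ≡.refl)

  fromℚ-* : ∀ p q → fromℚ (p ℚ.* q) ≃ fromℚ p * fromℚ q
  fromℚ-* p q = ≃-pointwise (λ _ → ≡.refl)

  fromℚ-neg : ∀ p → fromℚ (ℚ.- p) ≃ - fromℚ p
  fromℚ-neg p = ≃-pointwise (λ _ → ≡.refl)

  #⇒-#0 : ∀ {x y} → x # y → x + - y # 0ℝ
  #⇒-#0 {x} {y} (mk# (ε , ε>0 , N , away)) = mk# (ε , ε>0 , N , λ n N≤n →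
    subst (λ z → ε ℚ.≤ ∥ z ∥) (≡.sym (ℚ.+-identityʳ (seq x n ℚ.- seq y n))) (away n N≤n))

-- A ring solver for ℝ with rational coefficients, and cancellation.

ℝ-almostCommutativeRing : AlmostCommutativeRing _ _
ℝ-almostCommutativeRing = fromCommutativeRing ℝ-commutativeRing

fromℚ-morphism : ℚ.+-*-rawRing -Raw-AlmostCommutative⟶ ℝ-almostCommutativeRing
fromℚ-morphism = record
  { ⟦_⟧ = fromℚ ; +-homo = fromℚ-+ ; *-homo = fromℚ-* ; -‿homo = fromℚ-neg
  ; 0-homo = ≃-refl ; 1-homo = ≃-refl }

-- Coefficients are compared in ℚ, where equality is decidable.
fromℚ-≟ : WeaklyDecidable (Induced-equivalence fromℚ-morphism)
fromℚ-≟ p q = Maybe.map (ℝR.reflexive ∘ cong fromℚ) (dec⇒maybe (p ℚ.≟ q))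

module ℝSolver =
  Algebra.Solver.Ring ℚ.+-*-rawRing ℝ-almostCommutativeRing fromℚ-morphism fromℚ-≟

-- Apartness supplies the inverse to multiply with; a vanishing product alone does not tell
-- constructively which factor vanishes.
#0-cancel : ∀ {x y} → x # 0ℝ → x * y ≃ 0ℝ → y ≃ 0ℝ
#0-cancel {x} {y} x#0 xy≃0 = begin
  y                 ≈⟨ ℝR.*-identityˡ y ⟨
  1ℝ * y            ≈⟨ *-cong (*-inverseʳ x x#0) ≃-refl ⟨
  x * x⁻¹ * y       ≈⟨ solve 3 (λ x x⁻¹ y → x :* x⁻¹ :* y := x⁻¹ :* (x :* y)) ≃-refl x x⁻¹ y ⟩
  x⁻¹ * (x * y)     ≈⟨ *-cong ≃-refl xy≃0 ⟩
  x⁻¹ * 0ℝ          ≈⟨ ℝR.zeroʳ x⁻¹ ⟩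
  0ℝ                ∎
  where
  open ≃-Reasoning
  open ℝSolver
  x⁻¹ = inverse x x#0

-≃0⇒≃ : ∀ {x y} → x + - y ≃ 0ℝ → x ≃ y
-≃0⇒≃ {x} {y} x-y≃0 = begin
  x              ≈⟨ solve 2 (λ x y → x := x :- y :+ y) ≃-refl x y ⟩
  x + - y + y    ≈⟨ +-cong x-y≃0 ≃-refl ⟩
  0ℝ + y         ≈⟨ +-identityˡ y ⟩
  y              ∎
  where
  open ≃-Reasoning
  open ℝSolver

#0-cancelˡ : ∀ {x y z} → x # 0ℝ → x * y ≃ x * z → y ≃ z
#0-cancelˡ {x} {y} {z} x#0 xy≃xz = -≃0⇒≃ (#0-cancel x#0 (begin
  x * (y + - z)        ≈⟨ solve 3 (λ x y z → x :* (y :- z) := x :* y :- x :* z) ≃-refl x y z ⟩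
  x * y + - (x * z)    ≈⟨ +-cong xy≃xz ≃-refl ⟩
  x * z + - (x * z)    ≈⟨ ℝR.-‿inverseʳ (x * z) ⟩
  0ℝ                   ∎))
  where
  open ≃-Reasoning
  open ℝSolver

0<∥-∥ : ∀ {p q} → p ≢ q → 0ℚ ℚ.< ∥ p ℚ.- q ∥
0<∥-∥ {p} {q} p≢q = ℚ.≰⇒> (λ d≤0 →
  p≢q (p-q≡0⇒p≡q (ℚ.∣p∣≡0⇒p≡0 (p ℚ.- q) (ℚ.≤-antisym d≤0 (ℚ.0≤∣p∣ (p ℚ.- q))))))
  where
  p-q≡0⇒p≡q = GroupProperties.x∙y⁻¹≈ε⇒x≈y ℚ.+-0-group p q

fromℚ-# : ∀ {p q} → p ≢ q → fromℚ p # fromℚ q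
fromℚ-# {p} {q} p≢q = mk# (∥ p ℚ.- q ∥ , 0<∥-∥ p≢q , 0 , λ _ _ → ℚ.≤-refl)

-- Once the sequence of θ varies by less than ε/4, where ε = ∣p - q∣, one of its
-- terms tells on which side θ stays.
#-cotrans : ∀ θ {p q} → p ≢ q → θ # fromℚ p ⊎ θ # fromℚ q
#-cotrans θ {p} {q} p≢q with Estimates.half ∥ p ℚ.- q ∥ (0<∥-∥ p≢q)
... | δ , δ>0 , δ+δ≡ε with Estimates.half δ δ>0
... | η , η>0 , η+η≡δ with cauchy θ η η>0
... | N , near = decide (δ ℚ.≤? ∥ t ℚ.- p ∥) (δ ℚ.≤? ∥ t ℚ.- q ∥)
  where
  t = seq θ N

  stays : ∀ s → δ ℚ.≤ ∥ t ℚ.- s ∥ → θ # fromℚ s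
  -- A later term within η of s would put `t` within `η + η = δ` of s.
  stays s δ≤ = mk# (η , η>0 , N , λ n N≤n → ℚ.≮⇒≥ λ close →
    ℚ.<-irrefl ≡.refl (ℚ.≤-<-trans δ≤ (subst (∥ t ℚ.- s ∥ ℚ.<_) η+η≡δ
      (Estimates.triangle {a = t} {s} (seq θ n) (near N n ℕ.≤-refl N≤n) close))))

  decide : Dec (δ ℚ.≤ ∥ t ℚ.- p ∥) → Dec (δ ℚ.≤ ∥ t ℚ.- q ∥) → θ # fromℚ p ⊎ θ # fromℚ q
  decide (yes δ≤) _        = inj₁ (stays p δ≤)
  decide (no _)   (yes δ≤) = inj₂ (stays q δ≤)
  decide (no p≈t) (no q≈t) = contradiction
    (subst (∥ p ℚ.- q ∥ ℚ.<_) δ+δ≡ε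
      (Estimates.triangle {a = p} {q} t
        (subst (ℚ._< δ) (Estimates.dist-sym t p) (ℚ.≰⇒> p≈t)) (ℚ.≰⇒> q≈t)))
    (ℚ.<-irrefl ≡.refl)

-- Natural numbers in ℝ and their square roots.

ι : ℕ → ℝ
ι n = fromℚ (+ n ℚ./ 1)

ι-+ : ∀ m n → ι (m ℕ.+ n) ≃ ι m + ι n
ι-+ m n = ≃-trans (ℝR.reflexive (cong fromℚ (≡.sym (/-+ m n 0))))
                  (fromℚ-+ (+ m ℚ./ 1) (+ n ℚ./ 1))

ι-* : ∀ m n → ι (m ℕ.* n) ≃ ι m * ι n
ι-* m n = ≃-trans (ℝR.reflexive (cong fromℚ (≡.sym (/-* m n 0 0))))
                  (fromℚ-* (+ m ℚ./ 1) (+ n ℚ./ 1))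

ι-cong : ∀ {m n} → m ≡ n → ι m ≃ ι n
ι-cong m≡n = ℝR.reflexive (cong ι m≡n)

/1-injective : ∀ {m n} → + m ℚ./ 1 ≡ + n ℚ./ 1 → m ≡ n
/1-injective {m} {n} eq = ℤ.+-injective
  (ℤ.*-cancelʳ-≡ (+ m) (+ n) (+ 1)
    (ℚᵘ.drop-*≡* (ℚ./-injective-≃ (ℚᵘ.mkℚᵘ (+ m) 0) (ℚᵘ.mkℚᵘ (+ n) 0) eq)))

ι#0 : ∀ n → .{{ℕ.NonZero n}} → ι n # 0ℝ
ι#0 n@(suc _) = fromℚ-# {+ n ℚ./ 1} {0ℚ} (λ eq → ℕ.1+n≢0 (/1-injective {n} {0} eq))

ι-sum : ∀ {n} (f : Fin n → ℕ) → ι (ℕΣ.sum f) ≃ sum (ι ∘ f)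
ι-sum {zero}  f = ≃-refl
ι-sum {suc n} f = ≃-trans (ι-+ (f zero) _) (+-cong ≃-refl (ι-sum (f ∘ suc)))

sum-const : ∀ n x → sum {n} (λ _ → x) ≃ ι n * x
sum-const zero    x = ℝR.sym (ℝR.zeroˡ x)
sum-const (suc n) x = begin
  x + sum {n} (λ _ → x)    ≈⟨ +-cong (ℝR.*-identityˡ x) (≃-sym (sum-const n x)) ⟨
  1ℝ * x + ι n * x         ≈⟨ *-distribʳ-+ x 1ℝ (ι n) ⟨
  (1ℝ + ι n) * x           ≈⟨ *-cong (ι-+ 1 n) ≃-refl ⟨
  ι (suc n) * x            ∎
  where open ≃-Reasoning

isqrt-square : ∀ n → isqrt (n ℕ.* n) ≡ n
isqrt-square n = ℕ.≤-antisym
  (ℕ.≮⇒≥ λ n<a → ℕ.<⇒≱ (ℕ.*-mono-< n<a n<a) (isqrt-lower (n ℕ.* n)))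
  (ℕ.≤-pred (sq-cancel-< (isqrt-upper (n ℕ.* n))))

opaque
  unfolding √

  -- Every rational approximant is already exact, as `n * n * (suc m * suc m)` is the square of
  -- `n * suc m`.
  √-of-square : ∀ n → √ (n ℕ.* n) ≃ ι n
  √-of-square n = ≃-pointwise λ m → ≡.trans
    (cong (λ a → + a ℚ./ suc m)
      (≡.trans (cong isqrt (eq n (suc m))) (isqrt-square (n ℕ.* suc m))))
    (ℚ.≤-antisym
      (/-≤ {n ℕ.* suc m} {n} m 0 (ℕ.≤-reflexive (ℕ.*-identityʳ (n ℕ.* suc m))))
      (/-≤ {n} {n ℕ.* suc m} 0 m (ℕ.≤-reflexive (≡.sym (ℕ.*-identityʳ (n ℕ.* suc m))))))
    where
    open ℕSolver.+-*-Solver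
    eq : ∀ n m → n ℕ.* n ℕ.* (m ℕ.* m) ≡ (n ℕ.* m) ℕ.* (n ℕ.* m)
    eq = solve 2 (λ n m → n :* n :* (m :* m) := (n :* m) :* (n :* m)) ≡.refl

-- The value 0 at 0 makes the function total, so it can be rewritten along equalities of degrees
-- without transporting a proof that they are nonzero.
recip√ : ℕ → ℝ
recip√ zero      = 0ℝ
recip√ n@(suc _) = 1/√ n

1/√≡recip√ : ∀ n .{{_ : ℕ.NonZero n}} → 1/√ n ≡ recip√ n
1/√≡recip√ (suc _) = ≡.refl

recip√² : ∀ n .{{_ : ℕ.NonZero n}} → recip√ n * recip√ n * ι n ≃ 1ℝ
recip√² n@(suc _) = begin
  c * c * ι n          ≈⟨ *-cong ≃-refl (√-square n) ⟨
  c * c * (s * s)      ≈⟨ solve 2 (λ c s → c :* c :* (s :* s) := s :* c :* (s :* c)) ≃-refl c s ⟩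
  s * c * (s * c)      ≈⟨ *-cong (*-inverseʳ s (√#0 n)) (*-inverseʳ s (√#0 n)) ⟩
  1ℝ * 1ℝ              ≈⟨ *-identityˡ 1ℝ ⟩
  1ℝ                   ∎
  where
  open ≃-Reasoning
  open ℝSolver
  c = 1/√ n
  s = √ n

recip√-of-square : ∀ n .{{_ : ℕ.NonZero n}} → recip√ (n ℕ.* n) * ι n ≃ 1ℝ
recip√-of-square n@(suc _) = begin
  c * ι n          ≈⟨ *-comm c (ι n) ⟩
  ι n * c          ≈⟨ *-cong (√-of-square n) ≃-refl ⟨
  √ (n ℕ.* n) * c  ≈⟨ *-inverseʳ (√ (n ℕ.* n)) (√#0 (n ℕ.* n)) ⟩
  1ℝ               ∎
  where
  open ≃-Reasoning
  c = 1/√ (n ℕ.* n)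

-- Incidence counts

⟨_⟩ : ∀ {a} {P : Set a} → Dec P → ℕ
⟨ P? ⟩ = if does P? then 1 else 0

⟨⟩-true : ∀ {a} {P : Set a} (P? : Dec P) → P → ⟨ P? ⟩ ≡ 1
⟨⟩-true (yes _) _ = ≡.refl
⟨⟩-true (no ¬p) p = contradiction p ¬p

⟨⟩-false : ∀ {a} {P : Set a} (P? : Dec P) → ¬ P → ⟨ P? ⟩ ≡ 0
⟨⟩-false (yes p) ¬p = contradiction p ¬p
⟨⟩-false (no _)  _  = ≡.refl

δ : ∀ {n} → Fin n → Fin n → ℕ
δ i j = ⟨ i Fin.≟ j ⟩

length-filter-tabulate : ∀ {a p} {A : Set a} {P : Pred A p} (P? : Decidable P) {n} (f : Fin n → A) →
  List.length (List.filter P? (List.tabulate f)) ≡ ℕΣ.sum (λ i → ⟨ P? (f i) ⟩)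
length-filter-tabulate P? {zero}  f = ≡.refl
length-filter-tabulate P? {suc n} f with P? (f zero)
... | yes _ = cong suc (length-filter-tabulate P? (f ∘ suc))
... | no  _ = length-filter-tabulate P? (f ∘ suc)

degree≡sum : ∀ (G : Graph) u → let open Graph G in
  degree u ≡ ℕΣ.sum (λ i → ⟨ adj? u (Inverse.to enumeration i) ⟩)
degree≡sum G u = ≡.trans
  (cong (List.length ∘ List.filter (adj? u)) (List.map-tabulate id (Inverse.to enumeration)))
  (length-filter-tabulate (adj? u) (Inverse.to enumeration))
  where open Graph G

∣∣≡sum : ∀ {n} (S : Subset n) → ∣ S ∣ ≡ ℕΣ.sum (λ i → ⟨ i ∈? S ⟩)
∣∣≡sum []            = ≡.refl
∣∣≡sum (inside  ∷ S) = cong suc (∣∣≡sum S)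
∣∣≡sum (outside ∷ S) = ∣∣≡sum S

⟨∈∩⟩ : ∀ {n} (S T : Subset n) i → ⟨ i ∈? S ∩ T ⟩ ≡ ⟨ i ∈? S ⟩ ℕ.* ⟨ i ∈? T ⟩
⟨∈∩⟩ S T i with i ∈? S | i ∈? T
... | yes i∈S | yes i∈T = ⟨⟩-true (i ∈? S ∩ T) (x∈p∩q⁺ (i∈S , i∈T))
... | yes _   | no  i∉T = ⟨⟩-false (i ∈? S ∩ T) (i∉T ∘ proj₂ ∘ x∈p∩q⁻ S T)
... | no  i∉S | _       = ⟨⟩-false (i ∈? S ∩ T) (i∉S ∘ proj₁ ∘ x∈p∩q⁻ S T)

∣∣≤1 : ∀ {n} (S : Subset n) → (∀ {i j} → i ∈ S → j ∈ S → i ≡ j) → ∣ S ∣ ℕ.≤ 1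
∣∣≤1 {n} S unique with nonempty? S
... | yes (i , i∈S) = subst (∣ S ∣ ℕ.≤_) (∣⁅x⁆∣≡1 i)
  (p⊆q⇒∣p∣≤∣q∣ (λ j∈S → subst (_∈ ⁅ i ⁆) (unique i∈S j∈S) (x∈⁅x⁆ i)))
... | no  empty     = subst (ℕ._≤ 1) (≡.sym (≡.trans (cong ∣_∣ (Empty-unique empty)) (∣⊥∣≡0 n))) ℕ.z≤n

sum-δ : ∀ {n} i → ℕΣ.sum {n} (δ i) ≡ 1
sum-δ i = ≡.trans
  (ℕ-sum-single (δ i) i (λ j j≢i → ⟨⟩-false (i Fin.≟ j) (j≢i ∘ ≡.sym)))
  (⟨⟩-true (i Fin.≟ i) ≡.refl)

sum-1 : ∀ n → ℕΣ.sum {n} (λ _ → 1) ≡ n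
sum-1 zero    = ≡.refl
sum-1 (suc n) = cong suc (sum-1 n)

-- Incidence equations and valencies.

module Counting {v k b : ℕ} (D : Design v k b) where
  open Design D

  N : Fin v → Fin b → ℕ
  N p j = ⟨ p ∈? block j ⟩

  Nᵗ : Fin b → Fin v → ℕ
  Nᵗ j p = N p j

  A : Fin b → Fin b → ℕ
  A i j = ⟨ ΓAdj? D (inj₂ i) (inj₂ j) ⟩

  block-sum : ∀ j → ℕΣ.sum (Nᵗ j) ≡ k
  block-sum j = ≡.trans (≡.sym (∣∣≡sum (block j))) (block-size j)

  joint-sum : ∀ {p q} → p ≢ q → ℕΣ.sum (λ j → N p j ℕ.* N q j) ≡ 1
  joint-sum {p} {q} p≢q with joint-block p q p≢q
  ... | j , (p∈j , q∈j) , unique = ≡.trans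
    (ℕ-sum-single (λ i → N p i ℕ.* N q i) j vanish)
    (cong₂ ℕ._*_ (⟨⟩-true (p ∈? block j) p∈j) (⟨⟩-true (q ∈? block j) q∈j))
    where
    vanish : ∀ i → i ≢ j → N p i ℕ.* N q i ≡ 0
    vanish i i≢j with p ∈? block i | q ∈? block i
    ... | yes p∈i | yes q∈i = contradiction (≡.sym (unique (p∈i , q∈i))) i≢j
    ... | yes _   | no  _   = ≡.refl
    ... | no  _   | _       = ≡.refl

  N-idem : ∀ p j → N p j ℕ.* N p j ≡ N p j
  N-idem p j with p ∈? block j
  ... | yes _ = ≡.refl
  ... | no  _ = ≡.refl

  -- The entry counts the points common to two blocks. Distinct blocks share at most one point,
  -- since two shared points would lie in two joint blocks; a count that is at most 1 equals the
  -- indicator of its being 1.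
  NᵗN : ∀ i j → ℕΣ.sum (λ p → Nᵗ i p ℕ.* N p j) ≡ k ℕ.* δ i j ℕ.+ A i j
  NᵗN i j with i Fin.≟ j
  ... | yes ≡.refl = begin
    ℕΣ.sum (λ p → N p i ℕ.* N p i)    ≡⟨ ℕΣ.sum-cong-≗ (λ p → N-idem p i) ⟩
    ℕΣ.sum (Nᵗ i)                     ≡⟨ block-sum i ⟩
    k                                 ≡⟨ ℕ.*-identityʳ k ⟨
    k ℕ.* 1                           ≡⟨ ℕ.+-identityʳ (k ℕ.* 1) ⟨
    k ℕ.* 1 ℕ.+ 0                     ∎
    where open ≡.≡-Reasoning
  ... | no i≢j = begin
    ℕΣ.sum (λ p → N p i ℕ.* N p j)             ≡⟨ ℕΣ.sum-cong-≗ (⟨∈∩⟩ (block i) (block j)) ⟨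
    ℕΣ.sum (λ p → ⟨ p ∈? block i ∩ block j ⟩)   ≡⟨ ∣∣≡sum (block i ∩ block j) ⟨
    ∣ block i ∩ block j ∣                      ≡⟨ ≤1⇒⟨≟1⟩ (∣∣≤1 (block i ∩ block j) unique) ⟩
    ⟨ ∣ block i ∩ block j ∣ ℕ.≟ 1 ⟩             ≡⟨ cong (ℕ._+ ⟨ ∣ block i ∩ block j ∣ ℕ.≟ 1 ⟩) (ℕ.*-zeroʳ k) ⟨
    k ℕ.* 0 ℕ.+ ⟨ ∣ block i ∩ block j ∣ ℕ.≟ 1 ⟩ ∎
    where
    open ≡.≡-Reasoning
    unique : ∀ {p q} → p ∈ block i ∩ block j → q ∈ block i ∩ block j → p ≡ q
    unique {p} {q} p∈ q∈ with p Fin.≟ q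
    ... | yes p≡q = p≡q
    ... | no  p≢q with joint-block p q p≢q | x∈p∩q⁻ (block i) (block j) p∈ | x∈p∩q⁻ (block i) (block j) q∈
    ...   | _ , _ , same | p∈i , p∈j | q∈i , q∈j =
      contradiction (≡.trans (≡.sym (same (p∈i , q∈i))) (same (p∈j , q∈j))) i≢j
    ≤1⇒⟨≟1⟩ : ∀ {n} → n ℕ.≤ 1 → n ≡ ⟨ n ℕ.≟ 1 ⟩
    ≤1⇒⟨≟1⟩ ℕ.z≤n         = ≡.refl
    ≤1⇒⟨≟1⟩ (ℕ.s≤s ℕ.z≤n) = ≡.refl

  -- The entry counts the blocks through both points. Adding `δ p q` avoids a truncated subtraction
  -- while the degree of p is not yet known to be positive.
  NNᵗ+δ : ∀ p q → ℕΣ.sum (λ j → N p j ℕ.* Nᵗ j q) ℕ.+ δ p q ≡ 1 ℕ.+ ℕΣ.sum (N p) ℕ.* δ p q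
  NNᵗ+δ p q with p Fin.≟ q
  ... | no p≢q = ≡.trans (cong (ℕ._+ 0) (joint-sum p≢q))
                         (cong suc (≡.sym (ℕ.*-zeroʳ (ℕΣ.sum (N p)))))
  ... | yes ≡.refl = begin
    ℕΣ.sum (λ j → N p j ℕ.* N p j) ℕ.+ 1    ≡⟨ ℕ.+-comm _ 1 ⟩
    suc (ℕΣ.sum (λ j → N p j ℕ.* N p j))    ≡⟨ cong suc (ℕΣ.sum-cong-≗ (N-idem p)) ⟩
    suc (ℕΣ.sum (N p))                      ≡⟨ cong suc (ℕ.*-identityʳ (ℕΣ.sum (N p))) ⟨
    suc (ℕΣ.sum (N p) ℕ.* 1)                ∎
    where open ≡.≡-Reasoning

  -- Double counting of the pairs (j , q) with both p and q on the block j.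
  point-sum : ∀ p → ℕΣ.sum (N p) ℕ.* k ℕ.+ 1 ≡ v ℕ.+ ℕΣ.sum (N p)
  point-sum p = begin
    r ℕ.* k ℕ.+ 1
      ≡⟨ cong (ℕ._+ 1) (ℕΣ.*-distribʳ-sum k (N p)) ⟩
    ℕΣ.sum (λ j → N p j ℕ.* k) ℕ.+ 1
      -- The added 1 becomes the row sum of `δ p`, so that `NNᵗ+δ` applies term by term after the
      -- interchange of sums.
      ≡⟨ cong₂ ℕ._+_ (ℕΣ.sum-cong-≗ λ j →
           ≡.trans (cong (N p j ℕ.*_) (≡.sym (block-sum j))) (ℕΣ.*-distribˡ-sum (N p j) (Nᵗ j)))
           (≡.sym (sum-δ p)) ⟩
    ℕΣ.sum (λ j → ℕΣ.sum (λ q → N p j ℕ.* N q j)) ℕ.+ ℕΣ.sum (δ p)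
      ≡⟨ cong (ℕ._+ ℕΣ.sum (δ p)) (ℕΣ.∑-comm (λ j q → N p j ℕ.* N q j)) ⟩
    ℕΣ.sum (λ q → ℕΣ.sum (λ j → N p j ℕ.* N q j)) ℕ.+ ℕΣ.sum (δ p)
      ≡⟨ ℕΣ.∑-distrib-+ (λ q → ℕΣ.sum (λ j → N p j ℕ.* N q j)) (δ p) ⟨
    ℕΣ.sum (λ q → ℕΣ.sum (λ j → N p j ℕ.* N q j) ℕ.+ δ p q)
      ≡⟨ ℕΣ.sum-cong-≗ (NNᵗ+δ p) ⟩
    ℕΣ.sum (λ q → 1 ℕ.+ r ℕ.* δ p q)
      ≡⟨ ℕΣ.∑-distrib-+ {v} (λ _ → 1) (λ q → r ℕ.* δ p q) ⟩
    ℕΣ.sum {v} (λ _ → 1) ℕ.+ ℕΣ.sum (λ q → r ℕ.* δ p q)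
      ≡⟨ cong₂ ℕ._+_ (sum-1 v) (≡.sym (ℕΣ.*-distribˡ-sum r (δ p))) ⟩
    v ℕ.+ r ℕ.* ℕΣ.sum (δ p)
      ≡⟨ cong (v ℕ.+_) (≡.trans (cong (r ℕ.*_) (sum-δ p)) (ℕ.*-identityʳ r)) ⟩
    v ℕ.+ r
      ∎
    where
    open ≡.≡-Reasoning
    r = ℕΣ.sum (N p)

  -- Makes the degree the quotient of `v ∸ 1` by `k ∸ 1`, hence the same for all points and equal to
  -- `replication D`.
  point-sum′ : ∀ p → ℕΣ.sum (N p) ℕ.* (k ℕ.∸ 1) ≡ v ℕ.∸ 1
  point-sum′ p = begin
    r ℕ.* (k ℕ.∸ 1)                        ≡⟨ ℕ.*-distribˡ-∸ r k 1 ⟩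
    r ℕ.* k ℕ.∸ r ℕ.* 1                    ≡⟨ cong (r ℕ.* k ℕ.∸_) (ℕ.*-identityʳ r) ⟩
    -- With 1 added to both terms, the minuend becomes the left side of `point-sum`.
    r ℕ.* k ℕ.∸ r                          ≡⟨ ℕ.[m+n]∸[m+o]≡n∸o 1 (r ℕ.* k) r ⟨
    (1 ℕ.+ r ℕ.* k) ℕ.∸ (1 ℕ.+ r)          ≡⟨ cong₂ ℕ._∸_ (≡.trans (ℕ.+-comm 1 (r ℕ.* k)) (≡.trans (point-sum p) (ℕ.+-comm v r))) (ℕ.+-comm 1 r) ⟩
    (r ℕ.+ v) ℕ.∸ (r ℕ.+ 1)                ≡⟨ ℕ.[m+n]∸[m+o]≡n∸o r v 1 ⟩
    v ℕ.∸ 1                                ∎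
    where
    open ≡.≡-Reasoning
    r = ℕΣ.sum (N p)

  instance
    k-1≢0 : ℕ.NonZero (k ℕ.∸ 1)
    k-1≢0 = ℕ.>-nonZero (ℕ.m<n⇒0<n∸m 2≤k)

    k≢0 : ℕ.NonZero k
    k≢0 = ℕ.>-nonZero (ℕ.<-trans (ℕ.s≤s ℕ.z≤n) 2≤k)

  0<v : 0 < v
  0<v = ℕ.≤-<-trans ℕ.z≤n k<v

  1<v : 1 < v
  1<v = ℕ.≤-<-trans (ℕ.<⇒≤ 2≤k) k<v

  p₀ : Fin v
  p₀ = fromℕ< 0<v

  p₁ : Fin v
  p₁ = fromℕ< 1<v

  p₀≢p₁ : p₀ ≢ p₁
  p₀≢p₁ eq = ℕ.0≢1+n (Fin.fromℕ<-injective 0 1 0<v 1<v eq)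

  -- The degree of one chosen point; `point-degree` shows that every point has it.
  r : ℕ
  r = ℕΣ.sum (N p₀)

  instance
    r≢0 : ℕ.NonZero r
    r≢0 = ℕ.≢-nonZero λ r≡0 → ℕ.<⇒≢ (ℕ.m<n⇒0<n∸m 1<v)
      (≡.trans (≡.sym (cong (ℕ._* (k ℕ.∸ 1)) r≡0)) (point-sum′ p₀))

    kr≢0 : ℕ.NonZero (k ℕ.* r)
    kr≢0 = ℕ.m*n≢0 k r

  point-degree : ∀ p → ℕΣ.sum (N p) ≡ r
  point-degree p = ℕ.*-cancelʳ-≡ (ℕΣ.sum (N p)) r (k ℕ.∸ 1)
    (≡.trans (point-sum′ p) (≡.sym (point-sum′ p₀)))

  ρ : ℕ
  ρ = ℕ.pred r

  r≡1+ρ : r ≡ suc ρ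
  r≡1+ρ = ≡.sym (ℕ.suc-pred r)

  -- By this identity the eigenvalue (k + ρ + v) / k of C Cᵀ on constant vectors is 1 + r.
  kr≡v+ρ : k ℕ.* r ≡ v ℕ.+ ρ
  kr≡v+ρ = ℕ.+-cancelʳ-≡ 1 (k ℕ.* r) (v ℕ.+ ρ) (begin
    k ℕ.* r ℕ.+ 1      ≡⟨ cong (ℕ._+ 1) (ℕ.*-comm k r) ⟩
    r ℕ.* k ℕ.+ 1      ≡⟨ point-sum p₀ ⟩
    v ℕ.+ r            ≡⟨ cong (v ℕ.+_) (≡.trans r≡1+ρ (ℕ.+-comm 1 ρ)) ⟩
    v ℕ.+ (ρ ℕ.+ 1)    ≡⟨ ℕ.+-assoc v ρ 1 ⟨
    v ℕ.+ ρ ℕ.+ 1      ∎)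
    where open ≡.≡-Reasoning

  NNᵗ : ∀ p q → ℕΣ.sum (λ j → N p j ℕ.* Nᵗ j q) ≡ ρ ℕ.* δ p q ℕ.+ 1
  NNᵗ p q = ℕ.+-cancelʳ-≡ (δ p q) _ _ (begin
    ℕΣ.sum (λ j → N p j ℕ.* N q j) ℕ.+ δ p q   ≡⟨ NNᵗ+δ p q ⟩
    1 ℕ.+ ℕΣ.sum (N p) ℕ.* δ p q               ≡⟨ cong (λ s → 1 ℕ.+ s ℕ.* δ p q) (≡.trans (point-degree p) r≡1+ρ) ⟩
    1 ℕ.+ suc ρ ℕ.* δ p q                      ≡⟨ solve 2 (λ ρ d → con 1 :+ (con 1 :+ ρ) :* d := ρ :* d :+ con 1 :+ d) ≡.refl ρ (δ p q) ⟩
    ρ ℕ.* δ p q ℕ.+ 1 ℕ.+ δ p q                ∎)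
    where
    open ≡.≡-Reasoning
    open ℕSolver.+-*-Solver

  -- A row sum of Nᵀ N is evaluated twice: entrywise by `NᵗN`, and point by point, where each of the
  -- k points on the block contributes r.
  block-degree : ∀ i → ℕΣ.sum (Nᵗ i) ℕ.+ ℕΣ.sum (A i) ≡ k ℕ.* r
  block-degree i = begin
    ℕΣ.sum (Nᵗ i) ℕ.+ ℕΣ.sum (A i)
      ≡⟨ cong (ℕ._+ ℕΣ.sum (A i)) (≡.trans (block-sum i) (≡.trans (≡.sym (ℕ.*-identityʳ k)) (cong (k ℕ.*_) (≡.sym (sum-δ i))))) ⟩
    k ℕ.* ℕΣ.sum (δ i) ℕ.+ ℕΣ.sum (A i)
      ≡⟨ cong (ℕ._+ ℕΣ.sum (A i)) (ℕΣ.*-distribˡ-sum k (δ i)) ⟩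
    ℕΣ.sum (λ j → k ℕ.* δ i j) ℕ.+ ℕΣ.sum (A i)
      ≡⟨ ℕΣ.∑-distrib-+ (λ j → k ℕ.* δ i j) (A i) ⟨
    ℕΣ.sum (λ j → k ℕ.* δ i j ℕ.+ A i j)
      ≡⟨ ℕΣ.sum-cong-≗ (NᵗN i) ⟨
    ℕΣ.sum (λ j → ℕΣ.sum (λ p → N p i ℕ.* N p j))
      ≡⟨ ℕΣ.∑-comm (λ j p → N p i ℕ.* N p j) ⟩
    ℕΣ.sum (λ p → ℕΣ.sum (λ j → N p i ℕ.* N p j))
      ≡⟨ ℕΣ.sum-cong-≗ (λ p → ≡.trans (≡.sym (ℕΣ.*-distribˡ-sum (N p i) (N p))) (cong (N p i ℕ.*_) (point-degree p))) ⟩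
    ℕΣ.sum (λ p → N p i ℕ.* r)
      ≡⟨ ℕΣ.*-distribʳ-sum r (Nᵗ i) ⟨
    ℕΣ.sum (Nᵗ i) ℕ.* r
      ≡⟨ cong (ℕ._* r) (block-sum i) ⟩
    k ℕ.* r
      ∎
    where open ≡.≡-Reasoning

  deg : Fin v ⊎ Fin b → ℕ
  deg (inj₁ _) = r
  deg (inj₂ _) = k ℕ.* r

  degree≡deg : ∀ u → Graph.degree (Γ D) u ≡ deg u
  degree≡deg (inj₁ p) = ≡.trans (degree≡sum (Γ D) (inj₁ p))
    (≡.trans (ℕ-sum-splitAt v (λ w → ⟨ ΓAdj? D (inj₁ p) w ⟩))
      (cong₂ ℕ._+_ (ℕΣ.sum-replicate-zero v) (point-degree p)))
  degree≡deg (inj₂ i) = ≡.trans (degree≡sum (Γ D) (inj₂ i))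
    (≡.trans (ℕ-sum-splitAt v (λ w → ⟨ ΓAdj? D (inj₂ i) w ⟩)) (block-degree i))

-- Matrices with natural entries acting on real vectors

act : ∀ {m n} → (Fin m → Fin n → ℕ) → (Fin n → ℝ) → Fin m → ℝ
act A x i = sum (λ j → ι (A i j) * x j)

module _ {m n} (A : Fin m → Fin n → ℕ) where

  act-cong : ∀ {x y} → (∀ j → x j ≃ y j) → ∀ i → act A x i ≃ act A y i
  act-cong x≃y i = ℝΣ.sum-cong-≋ (λ j → *-cong ≃-refl (x≃y j))

  act-+ : ∀ x y i → act A (λ j → x j + y j) i ≃ act A x i + act A y i
  act-+ x y i = ≃-trans (ℝΣ.sum-cong-≋ (λ j → ℝR.distribˡ (ι (A i j)) (x j) (y j)))
                        (ℝΣ.∑-distrib-+ (λ j → ι (A i j) * x j) (λ j → ι (A i j) * y j))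

  act-* : ∀ a x i → act A (λ j → a * x j) i ≃ a * act A x i
  act-* a x i = ≃-trans (ℝΣ.sum-cong-≋ (λ j → swap (ι (A i j)) (x j)))
                        (≃-sym (ℝΣ.*-distribˡ-sum a (λ j → ι (A i j) * x j)))
    where
    open ℝSolver
    swap : ∀ m y → m * (a * y) ≃ a * (m * y)
    swap m y = solve 3 (λ m a y → m :* (a :* y) := a :* (m :* y)) ≃-refl m a y

sum-δ-* : ∀ {n} i (x : Fin n → ℝ) → sum (λ j → ι (δ i j) * x j) ≃ x i
sum-δ-* i x = begin
  sum (λ j → ι (δ i j) * x j)    ≈⟨ sum-single _ i (λ j j≢i →
                                      ≃-trans (*-cong (ι-cong (⟨⟩-false (i Fin.≟ j) (j≢i ∘ ≡.sym))) ≃-refl)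
                                              (ℝR.zeroˡ (x j))) ⟩
  ι (δ i i) * x i                ≈⟨ *-cong (ι-cong (⟨⟩-true (i Fin.≟ i) ≡.refl)) ≃-refl ⟩
  1ℝ * x i                       ≈⟨ *-identityˡ (x i) ⟩
  x i                            ∎
  where open ≃-Reasoning

act-act : ∀ {l m n} (A : Fin l → Fin m → ℕ) (B : Fin m → Fin n → ℕ) x i →
          act A (act B x) i ≃ act (λ i j → ℕΣ.sum (λ h → A i h ℕ.* B h j)) x i
act-act A B x i = begin
  sum (λ h → ι (A i h) * sum (λ j → ι (B h j) * x j))
    ≈⟨ ℝΣ.sum-cong-≋ (λ h → ℝΣ.*-distribˡ-sum (ι (A i h)) (λ j → ι (B h j) * x j)) ⟩
  sum (λ h → sum (λ j → ι (A i h) * (ι (B h j) * x j)))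
    ≈⟨ ℝΣ.∑-comm (λ h j → ι (A i h) * (ι (B h j) * x j)) ⟩
  sum (λ j → sum (λ h → ι (A i h) * (ι (B h j) * x j)))
    ≈⟨ ℝΣ.sum-cong-≋ (λ j → ℝΣ.sum-cong-≋ (λ h →
         ≃-trans (≃-sym (*-assoc (ι (A i h)) (ι (B h j)) (x j)))
                 (*-cong (≃-sym (ι-* (A i h) (B h j))) ≃-refl))) ⟩
  sum (λ j → sum (λ h → ι (A i h ℕ.* B h j) * x j))
    ≈⟨ ℝΣ.sum-cong-≋ (λ j → ℝΣ.*-distribʳ-sum (x j) (λ h → ι (A i h ℕ.* B h j))) ⟨
  sum (λ j → sum (λ h → ι (A i h ℕ.* B h j)) * x j)
    ≈⟨ ℝΣ.sum-cong-≋ (λ j → *-cong (ι-sum (λ h → A i h ℕ.* B h j)) ≃-refl) ⟨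
  sum (λ j → ι (ℕΣ.sum (λ h → A i h ℕ.* B h j)) * x j)
    ∎
  where open ≃-Reasoning

-- Serves both incidence equations: `NNᵗ`, with M the all-ones matrix, and `NᵗN`, with M the
-- adjacency matrix of the block graph.
act-act-δ : ∀ {m n} (A : Fin m → Fin n → ℕ) (B : Fin n → Fin m → ℕ) a M →
            (∀ i j → ℕΣ.sum (λ h → A i h ℕ.* B h j) ≡ a ℕ.* δ i j ℕ.+ M i j) →
            ∀ x i → act A (act B x) i ≃ ι a * x i + act M x i
act-act-δ A B a M AB x i = begin
  act A (act B x) i
    ≈⟨ act-act A B x i ⟩
  sum (λ j → ι (ℕΣ.sum (λ h → A i h ℕ.* B h j)) * x j)
    ≈⟨ ℝΣ.sum-cong-≋ term ⟩
  sum (λ j → ι a * (ι (δ i j) * x j) + ι (M i j) * x j)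
    ≈⟨ ℝΣ.∑-distrib-+ (λ j → ι a * (ι (δ i j) * x j)) (λ j → ι (M i j) * x j) ⟩
  sum (λ j → ι a * (ι (δ i j) * x j)) + act M x i
    ≈⟨ +-cong (ℝΣ.*-distribˡ-sum (ι a) (λ j → ι (δ i j) * x j)) ≃-refl ⟨
  ι a * sum (λ j → ι (δ i j) * x j) + act M x i
    ≈⟨ +-cong (*-cong ≃-refl (sum-δ-* i x)) ≃-refl ⟩
  ι a * x i + act M x i
    ∎
  where
  open ≃-Reasoning
  open ℝSolver
  term : ∀ j → ι (ℕΣ.sum (λ h → A i h ℕ.* B h j)) * x j ≃ ι a * (ι (δ i j) * x j) + ι (M i j) * x j
  term j = begin
    ι (ℕΣ.sum (λ h → A i h ℕ.* B h j)) * x j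
      ≈⟨ *-cong (ι-cong (AB i j)) ≃-refl ⟩
    ι (a ℕ.* δ i j ℕ.+ M i j) * x j
      ≈⟨ *-cong (ι-+ (a ℕ.* δ i j) (M i j)) ≃-refl ⟩
    (ι (a ℕ.* δ i j) + ι (M i j)) * x j
      ≈⟨ *-cong (+-cong (ι-* a (δ i j)) ≃-refl) ≃-refl ⟩
    (ι a * ι (δ i j) + ι (M i j)) * x j
      ≈⟨ solve 4 (λ a d m y → (a :* d :+ m) :* y := a :* (d :* y) :+ m :* y) ≃-refl
           (ι a) (ι (δ i j)) (ι (M i j)) (x j) ⟩
    ι a * (ι (δ i j) * x j) + ι (M i j) * x j
      ∎

-- The normalized Laplacian as the identity minus a weighted adjacency matrix.

module _ (G : Graph) where
  open Graph G

  weight : Vertex → Vertex → ℝ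
  weight u w = ι ⟨ adj? u w ⟩ * recip√ (degree u ℕ.* degree w)

  -- The decision is arbitrary because u ≟ w would unfold, out of reach of with.
  normalizedLaplacian≃ : ∀ {u w} (u≟w : Dec (u ≡ w)) → .{{_ : ℕ.NonZero (degree u)}} →
    normalizedLaplacian u w ≃ ι ⟨ u≟w ⟩ + - weight u w
  normalizedLaplacian≃ {u} {w} u≟w with u ≟ w | adj? u w | u≟w
  ... | yes ≡.refl | yes uu | _ = contradiction uu adj-irrefl
  ... | yes u≡w    | no _   | no u≢w = contradiction u≡w u≢w
  ... | no u≢w     | _      | yes u≡w = contradiction u≡w u≢w
  ... | yes ≡.refl | no _   | yes _ with degree u
  -- Degree 0, where the diagonal entry would be 0, is excluded by the instance argument.
  ...   | suc d = solve 1 (λ y → con 1ℚ := con 1ℚ :- con 0ℚ :* y) ≃-refl (recip√ (suc d ℕ.* suc d))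
    where open ℝSolver
  normalizedLaplacian≃ {u} {w} u≟w | no _ | yes uw | no _ = ≃-trans
    (neg-cong (ℝR.reflexive (1/√≡recip√ (degree u ℕ.* degree w)
      {{ℕ.m*n≢0 _ _ {{adj⇒degree≢0 uw}} {{adj⇒degree≢0 (adj-sym uw)}}}})))
    (solve 1 (λ y → :- y := con 0ℚ :- con 1ℚ :* y) ≃-refl (recip√ (degree u ℕ.* degree w)))
    where open ℝSolver
  normalizedLaplacian≃ {u} {w} u≟w | no _ | no _ | no _ =
    solve 1 (λ y → con 0ℚ := con 0ℚ :- con 0ℚ :* y) ≃-refl (recip√ (degree u ℕ.* degree w))
    where open ℝSolver

  normalizedLaplacian-∑ : ∀ (x : Vertex → ℝ) u → .{{_ : ℕ.NonZero (degree u)}} →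
    ∑ (λ w → normalizedLaplacian u w * x w) ≃ x u + - ∑ (λ w → weight u w * x w)
  normalizedLaplacian-∑ x u = begin
    ∑ (λ w → normalizedLaplacian u w * x w)
      ≈⟨ ℝΣ.sum-cong-≋ (λ i → term (to i)) ⟩
    ∑ (λ w → ι ⟨ u ≟ w ⟩ * x w + - 1ℝ * (weight u w * x w))
      ≈⟨ ℝΣ.∑-distrib-+ (λ i → ι ⟨ u ≟ to i ⟩ * x (to i)) (λ i → - 1ℝ * (weight u (to i) * x (to i))) ⟩
    ∑ (λ w → ι ⟨ u ≟ w ⟩ * x w) + ∑ (λ w → - 1ℝ * (weight u w * x w))
      ≈⟨ +-cong diagonal (≃-sym (ℝΣ.*-distribˡ-sum (- 1ℝ) (λ i → weight u (to i) * x (to i)))) ⟩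
    x u + - 1ℝ * ∑ (λ w → weight u w * x w)
      ≈⟨ solve 2 (λ a s → a :+ (:- con 1ℚ) :* s := a :- s) ≃-refl (x u) (∑ (λ w → weight u w * x w)) ⟩
    x u + - ∑ (λ w → weight u w * x w)
      ∎
    where
    open ≃-Reasoning
    open ℝSolver
    open Inverse enumeration using (to; from; strictlyInverseˡ; strictlyInverseʳ)
    term : ∀ w → normalizedLaplacian u w * x w ≃ ι ⟨ u ≟ w ⟩ * x w + - 1ℝ * (weight u w * x w)
    term w = ≃-trans (*-cong (normalizedLaplacian≃ (u ≟ w)) ≃-refl)
      (solve 3 (λ d m y → (d :- m) :* y := d :* y :+ (:- con 1ℚ) :* (m :* y)) ≃-refl
        (ι ⟨ u ≟ w ⟩) (weight u w) (x w))
    diagonal : ∑ (λ w → ι ⟨ u ≟ w ⟩ * x w) ≃ x u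
    diagonal = begin
      ∑ (λ w → ι ⟨ u ≟ w ⟩ * x w)
        ≈⟨ sum-single (λ i → ι ⟨ u ≟ to i ⟩ * x (to i)) (from u) (λ j j≢ → ≃-trans
             (*-cong (ι-cong (⟨⟩-false (u ≟ to j) (λ u≡ →
               j≢ (≡.trans (≡.sym (strictlyInverseʳ j)) (cong from (≡.sym u≡)))))) ≃-refl)
             (ℝR.zeroˡ (x (to j)))) ⟩
      ι ⟨ u ≟ to (from u) ⟩ * x (to (from u))
        ≈⟨ ℝR.reflexive (cong (λ w → ι ⟨ u ≟ w ⟩ * x w) (strictlyInverseˡ u)) ⟩
      ι ⟨ u ≟ u ⟩ * x u
        ≈⟨ *-cong (ι-cong (⟨⟩-true (u ≟ u) ≡.refl)) ≃-refl ⟩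
      1ℝ * x u
        ≈⟨ *-identityˡ (x u) ⟩
      x u
        ∎

-- The spectrum of Γ

/≡/1 : ∀ {a n} d .{{_ : ℕ.NonZero d}} → n ℕ.* d ≡ a → + a ℚ./ d ≡ + n ℚ./ 1
/≡/1 {n = n} d@(suc m) ≡.refl = ℚ.≤-antisym
  (/-≤ {n ℕ.* d} {n} m 0 (ℕ.≤-reflexive (ℕ.*-identityʳ (n ℕ.* d))))
  (/-≤ {n} {n ℕ.* d} 0 m (ℕ.≤-reflexive (≡.sym (ℕ.*-identityʳ (n ℕ.* d)))))

*-1+1/ : ∀ q .{{_ : ℚ.NonZero q}} → q ℚ.* (1ℚ ℚ.+ ℚ.1/ q) ≡ q ℚ.+ 1ℚ
*-1+1/ q = ≡.trans (ℚ.*-distribˡ-+ q 1ℚ (ℚ.1/ q))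
  (cong₂ ℚ._+_ (ℚ.*-identityʳ q) (ℚ.*-inverseʳ q))

-- With q added on the left, the right side at q = r and c = k is the left side of `point-sum`.
*-1-1/+1/ : ∀ q c .{{_ : ℚ.NonZero q}} .{{_ : ℚ.NonZero c}} .{{_ : ℚ.NonZero (q ℚ.* c)}} →
            (q ℚ.* c) ℚ.* (1ℚ ℚ.- ℚ.1/ c ℚ.+ ℚ.1/ (q ℚ.* c)) ℚ.+ q ≡ q ℚ.* c ℚ.+ 1ℚ
*-1-1/+1/ q c = ≡.trans
  (solve 4 (λ q c c⁻¹ s → (q :* c) :* (con 1ℚ :- c⁻¹ :+ s) :+ q :=
                          q :* c :- q :* (c :* c⁻¹) :+ (q :* c) :* s :+ q) ≡.refl
    q c (ℚ.1/ c) (ℚ.1/ (q ℚ.* c)))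
  (≡.trans
    (cong₂ (λ s t → q ℚ.* c ℚ.- q ℚ.* s ℚ.+ t ℚ.+ q) (ℚ.*-inverseʳ c) (ℚ.*-inverseʳ (q ℚ.* c)))
    (solve 2 (λ q c → q :* c :- q :* con 1ℚ :+ con 1ℚ :+ q := q :* c :+ con 1ℚ) ≡.refl q c))
  where open ℚSolver.+-*-Solver

module Spectrum {v k b : ℕ} (D : Design v k b) where
  open Counting D

  private
    V = Fin v ⊎ Fin b

    /1-nonZero : ∀ n .{{_ : ℕ.NonZero n}} → ℚ.NonZero (+ n ℚ./ 1)
    /1-nonZero n = ℚ.pos⇒nonZero (+ n ℚ./ 1) {{ℚ.normalize-pos n 1}}

  -- The two non-zero values and their distinctness.

  θ₁ θ₂ : ℚ
  θ₁ = 1+1/r D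
  θ₂ = 1-1/k+1/rk D

  replication≡r : replication D ≡ + r ℚ./ 1
  replication≡r = /≡/1 {v ℕ.∸ 1} {r} (k ℕ.∸ 1) (point-sum′ p₀)

  -- Clearing denominators here and in `krθ₂` reduces the distinctness of the three values to
  -- inequalities between natural numbers.
  rθ₁ : (+ r ℚ./ 1) ℚ.* θ₁ ≡ + (r ℕ.+ 1) ℚ./ 1
  rθ₁ = ≡.trans (cong (ℚ._* θ₁) (≡.sym replication≡r))
    (≡.trans (*-1+1/ (replication D) {{q≢0}})
      (≡.trans (cong (ℚ._+ 1ℚ) replication≡r) (/-+ r 1 0)))
    where
    q≢0 : ℚ.NonZero (replication D)
    q≢0 = subst ℚ.NonZero (≡.sym replication≡r) (/1-nonZero r)

  krθ₂ : (+ (k ℕ.* r) ℚ./ 1) ℚ.* θ₂ ≡ + v ℚ./ 1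
  krθ₂ = GroupProperties.∙-cancelʳ ℚ.+-0-group (+ r ℚ./ 1) _ _ (begin
    (+ (k ℕ.* r) ℚ./ 1) ℚ.* θ₂ ℚ.+ + r ℚ./ 1    ≡⟨ cong₂ (λ s t → s ℚ.* θ₂ ℚ.+ t) qc (≡.sym replication≡r) ⟩
    (q ℚ.* c) ℚ.* θ₂ ℚ.+ q                      ≡⟨ *-1-1/+1/ q c {{q≢0}} {{/1-nonZero k}} {{qc≢0}} ⟩
    q ℚ.* c ℚ.+ 1ℚ                              ≡⟨ cong (ℚ._+ 1ℚ) qc ⟨
    + (k ℕ.* r) ℚ./ 1 ℚ.+ 1ℚ                    ≡⟨ /-+ (k ℕ.* r) 1 0 ⟩
    + (k ℕ.* r ℕ.+ 1) ℚ./ 1                     ≡⟨ cong (λ n → + n ℚ./ 1) (≡.trans (cong (ℕ._+ 1) (ℕ.*-comm k r)) (point-sum p₀)) ⟩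
    + (v ℕ.+ r) ℚ./ 1                           ≡⟨ /-+ v r 0 ⟨
    + v ℚ./ 1 ℚ.+ + r ℚ./ 1                     ∎)
    where
    open ≡.≡-Reasoning
    q = replication D
    c = + k ℚ./ 1
    qc : + (k ℕ.* r) ℚ./ 1 ≡ q ℚ.* c
    qc = ≡.trans (cong (λ n → + n ℚ./ 1) (ℕ.*-comm k r))
      (≡.trans (≡.sym (/-* r k 0 0)) (cong (ℚ._* c) (≡.sym replication≡r)))
    q≢0 : ℚ.NonZero q
    q≢0 = subst ℚ.NonZero (≡.sym replication≡r) (/1-nonZero r)
    qc≢0 : ℚ.NonZero (q ℚ.* c)
    qc≢0 = subst ℚ.NonZero qc (/1-nonZero (k ℕ.* r))

  0≢θ₁ : 0ℚ ≢ θ₁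
  0≢θ₁ 0≡θ₁ = ℕ.1+n≢0 (≡.trans (ℕ.+-comm 1 r) (/1-injective {r ℕ.+ 1} {0} (≡.trans (≡.sym rθ₁)
    (≡.trans (cong ((+ r ℚ./ 1) ℚ.*_) (≡.sym 0≡θ₁)) (ℚ.*-zeroʳ (+ r ℚ./ 1))))))

  0≢θ₂ : 0ℚ ≢ θ₂
  0≢θ₂ 0≡θ₂ = ℕ.<⇒≢ 0<v (/1-injective {0} {v} (≡.trans
    (≡.sym (ℚ.*-zeroʳ (+ (k ℕ.* r) ℚ./ 1)))
    (≡.trans (cong ((+ (k ℕ.* r) ℚ./ 1) ℚ.*_) 0≡θ₂) krθ₂)))

  -- Multiplied by k r, θ₂ becomes v and θ₁ becomes k r + k = v + ρ + k.
  θ₁≢θ₂ : θ₁ ≢ θ₂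
  θ₁≢θ₂ θ₁≡θ₂ = ℕ.<⇒≢ v<k[r+1] (/1-injective {v} {k ℕ.* (r ℕ.+ 1)} (begin
    + v ℚ./ 1                                     ≡⟨ krθ₂ ⟨
    (+ (k ℕ.* r) ℚ./ 1) ℚ.* θ₂                    ≡⟨ cong₂ ℚ._*_ (≡.sym (/-* k r 0 0)) (≡.sym θ₁≡θ₂) ⟩
    (+ k ℚ./ 1) ℚ.* (+ r ℚ./ 1) ℚ.* θ₁            ≡⟨ ℚ.*-assoc (+ k ℚ./ 1) (+ r ℚ./ 1) θ₁ ⟩
    (+ k ℚ./ 1) ℚ.* ((+ r ℚ./ 1) ℚ.* θ₁)          ≡⟨ cong ((+ k ℚ./ 1) ℚ.*_) rθ₁ ⟩
    (+ k ℚ./ 1) ℚ.* (+ (r ℕ.+ 1) ℚ./ 1)           ≡⟨ /-* k (r ℕ.+ 1) 0 0 ⟩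
    + (k ℕ.* (r ℕ.+ 1)) ℚ./ 1                     ∎))
    where
    open ≡.≡-Reasoning
    v<k[r+1] : v < k ℕ.* (r ℕ.+ 1)
    v<k[r+1] = ℕ.≤-<-trans
      (subst (v ℕ.≤_) (≡.sym kr≡v+ρ) (ℕ.m≤m+n v ρ))
      (ℕ.*-monoʳ-< k (ℕ.m<m+n r (ℕ.s≤s ℕ.z≤n)))

  -- The Laplacian of Γ in terms of C.

  R K W P : ℝ
  R = ι r
  K = ι k
  W = ι v
  P = ι ρ

  KR≃W+P : K * R ≃ W + P
  KR≃W+P = ≃-trans (≃-sym (ι-* k r)) (≃-trans (ι-cong kr≡v+ρ) (ι-+ v ρ))

  R*θ₁ : R * fromℚ θ₁ ≃ R + 1ℝ
  R*θ₁ = ≃-trans (≃-sym (fromℚ-* (+ r ℚ./ 1) θ₁)) (≃-trans (ℝR.reflexive (cong fromℚ rθ₁)) (ι-+ r 1))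

  KR*θ₂ : K * R * fromℚ θ₂ ≃ W
  KR*θ₂ = ≃-trans (*-cong (≃-sym (ι-* k r)) ≃-refl)
    (≃-trans (≃-sym (fromℚ-* (+ (k ℕ.* r) ℚ./ 1) θ₂)) (ℝR.reflexive (cong fromℚ krθ₂)))

  -- c and d are minus the off-diagonal Laplacian entries between a point and a
  -- block and between two blocks.
  c d e : ℝ
  c = recip√ (r ℕ.* (k ℕ.* r))
  d = recip√ ((k ℕ.* r) ℕ.* (k ℕ.* r))
  e = R * c

  -- Identifies `e` as 1/√k: its square is r² c², and c² is the reciprocal of r (k r).
  e²K≃1 : e * e * K ≃ 1ℝ
  e²K≃1 = begin
    R * c * (R * c) * K                ≈⟨ solve 3 (λ R c K → R :* c :* (R :* c) :* K := c :* c :* (R :* (K :* R))) ≃-refl R c K ⟩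
    c * c * (R * (K * R))              ≈⟨ *-cong ≃-refl (≃-trans (ι-* r (k ℕ.* r)) (*-cong ≃-refl (ι-* k r))) ⟨
    c * c * ι (r ℕ.* (k ℕ.* r))        ≈⟨ recip√² (r ℕ.* (k ℕ.* r)) {{ℕ.m*n≢0 r (k ℕ.* r)}} ⟩
    1ℝ                                 ∎
    where
    open ≃-Reasoning
    open ℝSolver

  -- As `d` is the inverse root of a square, it equals 1/(k r), and both sides are 1/k. So the
  -- entries between blocks fit the term e² A of Cᵀ C.
  Rd≃e² : R * d ≃ e * e
  Rd≃e² = begin
    R * d                    ≈⟨ *-identityˡ (R * d) ⟨
    1ℝ * (R * d)             ≈⟨ *-cong e²K≃1 ≃-refl ⟨
    e * e * K * (R * d)      ≈⟨ solve 4 (λ e K R d → e :* e :* K :* (R :* d) := e :* e :* (d :* (K :* R))) ≃-refl e K R d ⟩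
    e * e * (d * (K * R))    ≈⟨ *-cong ≃-refl (≃-trans (*-cong ≃-refl (≃-sym (ι-* k r))) (recip√-of-square (k ℕ.* r))) ⟩
    e * e * 1ℝ               ≈⟨ ℝR.*-identityʳ (e * e) ⟩
    e * e                    ∎
    where
    open ≃-Reasoning
    open ℝSolver

  C : (V → ℝ) → Fin v → ℝ
  C x p = x (inj₁ p) + e * act N (x ∘ inj₂) p

  Cᵀ : (Fin v → ℝ) → V → ℝ
  Cᵀ h (inj₁ p) = h p
  Cᵀ h (inj₂ j) = e * act Nᵗ h j

  C-cong : ∀ {x y} → (∀ u → x u ≃ y u) → ∀ p → C x p ≃ C y p
  C-cong x≃y p = +-cong (x≃y (inj₁ p)) (*-cong ≃-refl (act-cong N (x≃y ∘ inj₂) p))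

  C-* : ∀ a x p → C (λ u → a * x u) p ≃ a * C x p
  C-* a x p = ≃-trans (+-cong ≃-refl (*-cong ≃-refl (act-* N a (x ∘ inj₂) p)))
    (solve 4 (λ a y e z → a :* y :+ e :* (a :* z) := a :* (y :+ e :* z)) ≃-refl
      a (x (inj₁ p)) e (act N (x ∘ inj₂) p))
    where open ℝSolver

  Cᵀ-cong : ∀ {g h} → (∀ p → g p ≃ h p) → ∀ u → Cᵀ g u ≃ Cᵀ h u
  Cᵀ-cong g≃h (inj₁ p) = g≃h p
  Cᵀ-cong g≃h (inj₂ j) = *-cong ≃-refl (act-cong Nᵗ g≃h j)

  Cᵀ-* : ∀ a h u → Cᵀ (λ p → a * h p) u ≃ a * Cᵀ h u
  Cᵀ-* a h (inj₁ p) = ≃-refl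
  Cᵀ-* a h (inj₂ j) = ≃-trans (*-cong ≃-refl (act-* Nᵗ a h j))
    (solve 3 (λ e a z → e :* (a :* z) := a :* (e :* z)) ≃-refl e a (act Nᵗ h j))
    where open ℝSolver

  -- The factor `K` cancels the e² in front of N Nᵀ, which is ρ I + J.
  K*CCᵀ : ∀ h p → K * C (Cᵀ h) p ≃ (K + P) * h p + sum h
  K*CCᵀ h p = begin
    K * (h p + e * act N (λ j → e * act Nᵗ h j) p)
      ≈⟨ *-cong ≃-refl (+-cong ≃-refl (*-cong ≃-refl (act-* N e (act Nᵗ h) p))) ⟩
    K * (h p + e * (e * act N (act Nᵗ h) p))
      ≈⟨ solve 4 (λ K h e s → K :* (h :+ e :* (e :* s)) := K :* h :+ e :* e :* K :* s) ≃-refl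
           K (h p) e (act N (act Nᵗ h) p) ⟩
    K * h p + e * e * K * act N (act Nᵗ h) p
      ≈⟨ +-cong ≃-refl (*-cong e²K≃1 (act-act-δ N Nᵗ ρ (λ _ _ → 1) NNᵗ h p)) ⟩
    K * h p + 1ℝ * (P * h p + sum (λ q → 1ℝ * h q))
      ≈⟨ +-cong ≃-refl (*-cong ≃-refl (+-cong ≃-refl (ℝΣ.sum-cong-≋ (λ q → *-identityˡ (h q))))) ⟩
    K * h p + 1ℝ * (P * h p + sum h)
      ≈⟨ solve 4 (λ K P h s → K :* h :+ con 1ℚ :* (P :* h :+ s) := (K :+ P) :* h :+ s) ≃-refl
           K P (h p) (sum h) ⟩
    (K + P) * h p + sum h
      ∎
    where
    open ≃-Reasoning
    open ℝSolver

  open Graph (Γ D) using (∑; normalizedLaplacian; IsLEigenvalue; degree)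

  degree≢0 : ∀ u → ℕ.NonZero (degree u)
  degree≢0 u = subst ℕ.NonZero (≡.sym (degree≡deg u)) (deg≢0 u)
    where
    deg≢0 : ∀ u → ℕ.NonZero (deg u)
    deg≢0 (inj₁ _) = r≢0
    deg≢0 (inj₂ _) = kr≢0

  -- From a fixed vertex, the weight of an edge depends only on whether its other end is a point or
  -- a block.
  weighted-sum : ∀ (x : V → ℝ) u a₁ a₂ →
    (∀ q → weight (Γ D) u (inj₁ q) ≃ a₁ * ι ⟨ ΓAdj? D u (inj₁ q) ⟩) →
    (∀ j → weight (Γ D) u (inj₂ j) ≃ a₂ * ι ⟨ ΓAdj? D u (inj₂ j) ⟩) →
    ∑ (λ w → weight (Γ D) u w * x w) ≃
    a₁ * sum (λ q → ι ⟨ ΓAdj? D u (inj₁ q) ⟩ * x (inj₁ q)) +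
    a₂ * sum (λ j → ι ⟨ ΓAdj? D u (inj₂ j) ⟩ * x (inj₂ j))
  weighted-sum x u a₁ a₂ w₁ w₂ = ≃-trans (sum-splitAt v (λ w → weight (Γ D) u w * x w))
    (+-cong
      (≃-trans (ℝΣ.sum-cong-≋ (λ q → ≃-trans (*-cong (w₁ q) ≃-refl) (*-assoc a₁ _ (x (inj₁ q)))))
        (≃-sym (ℝΣ.*-distribˡ-sum a₁ (λ q → ι ⟨ ΓAdj? D u (inj₁ q) ⟩ * x (inj₁ q)))))
      (≃-trans (ℝΣ.sum-cong-≋ (λ j → ≃-trans (*-cong (w₂ j) ≃-refl) (*-assoc a₂ _ (x (inj₂ j)))))
        (≃-sym (ℝΣ.*-distribˡ-sum a₂ (λ j → ι ⟨ ΓAdj? D u (inj₂ j) ⟩ * x (inj₂ j))))))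

  weight≃ : ∀ u w {n} → deg u ℕ.* deg w ≡ n → weight (Γ D) u w ≃ recip√ n * ι ⟨ ΓAdj? D u w ⟩
  weight≃ u w ≡.refl = ≃-trans
    (*-cong ≃-refl (ℝR.reflexive (cong recip√ (cong₂ ℕ._*_ (degree≡deg u) (degree≡deg w)))))
    (*-comm _ _)

  -- The extra `1ℝ` beside `R` offsets the diagonal of Cᵀ C, which is 1 throughout: on points it
  -- comes from the identity part of C, and on blocks from e² k = 1.
  laplacian≃CᵀC : ∀ (x : V → ℝ) u →
    R * ∑ (λ w → normalizedLaplacian u w * x w) ≃ (1ℝ + R) * x u + - Cᵀ (C x) u
  laplacian≃CᵀC x u@(inj₁ p) = begin
    R * ∑ (λ w → normalizedLaplacian u w * x w)
      ≈⟨ *-cong ≃-refl (normalizedLaplacian-∑ (Γ D) x u {{degree≢0 u}}) ⟩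
    R * (x u + - ∑ (λ w → weight (Γ D) u w * x w))
      -- No two points are adjacent, so the point columns get the coefficient 0.
      ≈⟨ *-cong ≃-refl (+-cong ≃-refl (neg-cong (weighted-sum x u 0ℝ c
           (λ q → ≃-trans (ℝR.zeroˡ _) (≃-sym (ℝR.zeroˡ 0ℝ)))
           (λ j → weight≃ u (inj₂ j) ≡.refl)))) ⟩
    R * (x u + - (0ℝ * sum {v} (λ q → 0ℝ * x (inj₁ q)) + c * act N (x ∘ inj₂) p))
      ≈⟨ solve 5 (λ R y z c s → R :* (y :- (con 0ℚ :* z :+ c :* s)) :=
                                (con 1ℚ :+ R) :* y :- (y :+ R :* c :* s)) ≃-refl
           R (x u) (sum {v} (λ q → 0ℝ * x (inj₁ q))) c (act N (x ∘ inj₂) p) ⟩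
    (1ℝ + R) * x u + - C x p
      ∎
    where
    open ≃-Reasoning
    open ℝSolver
  laplacian≃CᵀC x u@(inj₂ i) = begin
    R * ∑ (λ w → normalizedLaplacian u w * x w)
      ≈⟨ *-cong ≃-refl (normalizedLaplacian-∑ (Γ D) x u {{degree≢0 u}}) ⟩
    R * (x u + - ∑ (λ w → weight (Γ D) u w * x w))
      ≈⟨ *-cong ≃-refl (+-cong ≃-refl (neg-cong (weighted-sum x u c d
           (λ q → weight≃ u (inj₁ q) (ℕ.*-comm (k ℕ.* r) r))
           (λ j → weight≃ u (inj₂ j) ≡.refl)))) ⟩
    R * (x u + - (c * y + d * z))
      ≈⟨ solve 6 (λ R xu c y d z → R :* (xu :- (c :* y :+ d :* z)) :=
                                   R :* xu :- R :* c :* y :- R :* d :* z) ≃-refl R (x u) c y d z ⟩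
    R * x u + - (e * y) + - (R * d * z)
      ≈⟨ +-cong ≃-refl (neg-cong (*-cong Rd≃e² ≃-refl)) ⟩
    R * x u + - (e * y) + - (e * e * z)
      -- The term with the vanishing factor `e * e * K - 1` is split off to complete `z` to
      -- `K * x u + z`, the action of Nᵀ N.
      ≈⟨ solve 6 (λ R xu e y z K → R :* xu :- e :* y :- e :* e :* z :=
                    (con 1ℚ :+ R) :* xu :- (e :* y :+ e :* e :* (K :* xu :+ z)) :+ (e :* e :* K :- con 1ℚ) :* xu)
           ≃-refl R (x u) e y z K ⟩
    (1ℝ + R) * x u + - (e * y + e * e * (K * x u + z)) + (e * e * K + - 1ℝ) * x u
      ≈⟨ +-cong ≃-refl (*-cong (≃-trans (+-cong e²K≃1 ≃-refl) (ℝR.-‿inverseʳ 1ℝ)) ≃-refl) ⟩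
    (1ℝ + R) * x u + - (e * y + e * e * (K * x u + z)) + 0ℝ * x u
      ≈⟨ solve 6 (λ R xu e y z K →
                    (con 1ℚ :+ R) :* xu :- (e :* y :+ e :* e :* (K :* xu :+ z)) :+ con 0ℚ :* xu :=
                    (con 1ℚ :+ R) :* xu :- e :* (y :+ e :* (K :* xu :+ z)))
           ≃-refl R (x u) e y z K ⟩
    (1ℝ + R) * x u + - (e * (y + e * (K * x u + z)))
      ≈⟨ +-cong ≃-refl (neg-cong (*-cong ≃-refl (+-cong ≃-refl (≃-trans
           (act-* Nᵗ e (act N (x ∘ inj₂)) i)
           (*-cong ≃-refl (act-act-δ Nᵗ N k A NᵗN (x ∘ inj₂) i)))))) ⟨
    (1ℝ + R) * x u + - (e * (y + act Nᵗ (λ p → e * act N (x ∘ inj₂) p) i))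
      ≈⟨ +-cong ≃-refl (neg-cong (*-cong ≃-refl
           (act-+ Nᵗ (x ∘ inj₁) (λ p → e * act N (x ∘ inj₂) p) i))) ⟨
    (1ℝ + R) * x u + - Cᵀ (C x) u
      ∎
    where
    open ≃-Reasoning
    open ℝSolver
    y = act Nᵗ (x ∘ inj₁) i
    z = act A (x ∘ inj₂) i

  -- Eigenvectors for the three values.

  eigenvalue : ∀ {θ} μ → μ + R * θ ≃ 1ℝ + R → ∀ x u → x u # 0ℝ →
               (∀ w → Cᵀ (C x) w ≃ μ * x w) → IsLEigenvalue θ
  eigenvalue {θ} μ μ+Rθ x u xu#0 CᵀCx = x , (u , xu#0) , λ w → #0-cancelˡ (ι#0 r) (begin
    R * ∑ (λ w′ → normalizedLaplacian w w′ * x w′)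
      ≈⟨ laplacian≃CᵀC x w ⟩
    (1ℝ + R) * x w + - Cᵀ (C x) w
      ≈⟨ +-cong (*-cong (≃-sym μ+Rθ) ≃-refl) (neg-cong (CᵀCx w)) ⟩
    (μ + R * θ) * x w + - (μ * x w)
      ≈⟨ solve 4 (λ μ R θ y → (μ :+ R :* θ) :* y :- μ :* y := R :* (θ :* y)) ≃-refl μ R θ (x w) ⟩
    R * (θ * x w)
      ∎)
    where
    open ≃-Reasoning
    open ℝSolver

  -- An eigenvector h of C Cᵀ yields the eigenvector Cᵀ h of Cᵀ C for the same μ; it is non-zero
  -- because its point coordinates are h itself.
  point-eigenvalue : ∀ {θ} μ → μ + R * θ ≃ 1ℝ + R → ∀ h p → h p # 0ℝ →
                     (∀ q → (K + P) * h q + sum h ≃ K * μ * h q) → IsLEigenvalue θ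
  point-eigenvalue μ μ+Rθ h p hp#0 CCᵀh = eigenvalue μ μ+Rθ (Cᵀ h) (inj₁ p) hp#0 λ w →
    ≃-trans (Cᵀ-cong (λ q → #0-cancelˡ (ι#0 k)
      (≃-trans (K*CCᵀ h q) (≃-trans (CCᵀh q) (*-assoc K μ (h q))))) w)
      (Cᵀ-* μ h w)

  -- Comes from the constant vector, on which C Cᵀ acts as 1 + r.
  0-eigenvalue : ∀ {θ} → θ ≃ 0ℝ → IsLEigenvalue θ
  0-eigenvalue {θ} θ≃0 = point-eigenvalue (1ℝ + R)
    (≃-trans (+-cong ≃-refl (*-cong ≃-refl θ≃0))
      (solve 1 (λ R → con 1ℚ :+ R :+ R :* con 0ℚ := con 1ℚ :+ R) ≃-refl R))
    (λ _ → 1ℝ) p₀ (ι#0 1) λ _ → begin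
      (K + P) * 1ℝ + sum {v} (λ _ → 1ℝ)    ≈⟨ +-cong ≃-refl (sum-const v 1ℝ) ⟩
      (K + P) * 1ℝ + W * 1ℝ                ≈⟨ solve 3 (λ K P W → (K :+ P) :* con 1ℚ :+ W :* con 1ℚ := K :+ (W :+ P)) ≃-refl K P W ⟩
      K + (W + P)                          ≈⟨ +-cong ≃-refl KR≃W+P ⟨
      K + K * R                            ≈⟨ solve 2 (λ K R → K :+ K :* R := K :* (con 1ℚ :+ R) :* con 1ℚ) ≃-refl K R ⟩
      K * (1ℝ + R) * 1ℝ                    ∎
    where
    open ≃-Reasoning
    open ℝSolver

  θ₂-eigenvalue : ∀ {θ} → θ ≃ fromℚ θ₂ → IsLEigenvalue θ
  θ₂-eigenvalue {θ} θ≃θ₂ = point-eigenvalue μ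
    (solve 2 (λ R θ → con 1ℚ :+ R :- R :* θ :+ R :* θ := con 1ℚ :+ R) ≃-refl R θ)
    h p₀ h₀#0 λ q → begin
      (K + P) * h q + sum h          ≈⟨ +-cong ≃-refl sum-h ⟩
      (K + P) * h q + 0ℝ             ≈⟨ solve 4 (λ K P W y → (K :+ P) :* y :+ con 0ℚ := (K :+ (W :+ P) :- W) :* y) ≃-refl K P W (h q) ⟩
      (K + (W + P) + - W) * h q      ≈⟨ *-cong Kμ ≃-refl ⟨
      K * μ * h q                    ∎
    where
    open ≃-Reasoning
    open ℝSolver
    -- This choice makes the relation between μ and θ an identity; `Kμ` then shows that K μ is K +
    -- P, as required on vectors of sum 0.
    μ = 1ℝ + R + - (R * θ)
    h : Fin v → ℝ
    -- The difference of the indicators of two points has sum 0.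
    h q = ι (δ p₀ q) + - ι (δ p₁ q)
    h₀#0 : h p₀ # 0ℝ
    h₀#0 = #⇒-#0 (subst₂ (λ m n → ι m # ι n)
      (≡.sym (⟨⟩-true (p₀ Fin.≟ p₀) ≡.refl))
      (≡.sym (⟨⟩-false (p₁ Fin.≟ p₀) (p₀≢p₁ ∘ ≡.sym)))
      (ι#0 1))
    sum-h : sum h ≃ 0ℝ
    sum-h = begin
      sum h
        ≈⟨ ℝΣ.sum-cong-≋ (λ q → solve 2 (λ s t → s :- t := s :+ (:- con 1ℚ) :* t) ≃-refl (ι (δ p₀ q)) (ι (δ p₁ q))) ⟩
      sum (λ q → ι (δ p₀ q) + - 1ℝ * ι (δ p₁ q))
        ≈⟨ ℝΣ.∑-distrib-+ (ι ∘ δ p₀) (λ q → - 1ℝ * ι (δ p₁ q)) ⟩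
      sum (ι ∘ δ p₀) + sum (λ q → - 1ℝ * ι (δ p₁ q))
        ≈⟨ +-cong (ι-sum (δ p₀)) (ℝΣ.*-distribˡ-sum (- 1ℝ) (ι ∘ δ p₁)) ⟨
      ι (ℕΣ.sum (δ p₀)) + - 1ℝ * sum (ι ∘ δ p₁)
        ≈⟨ +-cong (ι-cong (sum-δ p₀)) (*-cong ≃-refl (≃-trans (≃-sym (ι-sum (δ p₁))) (ι-cong (sum-δ p₁)))) ⟩
      1ℝ + - 1ℝ * 1ℝ
        ≈⟨ solve 0 (con 1ℚ :+ (:- con 1ℚ) :* con 1ℚ := con 0ℚ) ≃-refl ⟩
      0ℝ
        ∎
    Kμ : K * μ ≃ K + (W + P) + - W
    Kμ = begin
      K * (1ℝ + R + - (R * θ))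
        ≈⟨ solve 3 (λ K R θ → K :* (con 1ℚ :+ R :- R :* θ) := K :+ K :* R :- K :* R :* θ) ≃-refl K R θ ⟩
      K + K * R + - (K * R * θ)
        ≈⟨ +-cong (+-cong ≃-refl KR≃W+P) (neg-cong (≃-trans (*-cong ≃-refl θ≃θ₂) KR*θ₂)) ⟩
      K + (W + P) + - W
        ∎

  -- The kernel of C gives μ = 0. Because C begins with an identity matrix, the block coordinates of
  -- a kernel vector are free and determine its point coordinates; here they single out one block.
  θ₁-eigenvalue : 0 < b → ∀ {θ} → θ ≃ fromℚ θ₁ → IsLEigenvalue θ
  θ₁-eigenvalue 0<b {θ} θ≃θ₁ = eigenvalue 0ℝ 0+Rθ x (inj₂ j₀) x₀#0 λ w → begin
    Cᵀ (C x) w                    ≈⟨ Cᵀ-cong (λ p → ≃-trans (Cx p) (≃-sym (ℝR.zeroˡ (C x p)))) w ⟩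
    Cᵀ (λ p → 0ℝ * C x p) w       ≈⟨ Cᵀ-* 0ℝ (C x) w ⟩
    0ℝ * Cᵀ (C x) w               ≈⟨ solve 2 (λ s t → con 0ℚ :* s := con 0ℚ :* t) ≃-refl (Cᵀ (C x) w) (x w) ⟩
    0ℝ * x w                      ∎
    where
    open ≃-Reasoning
    open ℝSolver
    j₀ : Fin b
    j₀ = fromℕ< 0<b
    x : V → ℝ
    x (inj₁ p) = - (e * ι (N p j₀))
    x (inj₂ j) = ι (δ j₀ j)
    x₀#0 : x (inj₂ j₀) # 0ℝ
    x₀#0 = subst (λ n → ι n # 0ℝ) (≡.sym (⟨⟩-true (j₀ Fin.≟ j₀) ≡.refl)) (ι#0 1)
    0+Rθ : 0ℝ + R * θ ≃ 1ℝ + R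
    0+Rθ = ≃-trans (+-identityˡ (R * θ))
      (≃-trans (*-cong ≃-refl θ≃θ₁) (≃-trans R*θ₁ (+-comm R 1ℝ)))
    Cx : ∀ p → C x p ≃ 0ℝ
    Cx p = begin
      - (e * ι (N p j₀)) + e * sum (λ j → ι (N p j) * ι (δ j₀ j))
        ≈⟨ +-cong ≃-refl (*-cong ≃-refl (≃-trans
             (ℝΣ.sum-cong-≋ (λ j → *-comm (ι (N p j)) (ι (δ j₀ j)))) (sum-δ-* j₀ (ι ∘ N p)))) ⟩
      - (e * ι (N p j₀)) + e * ι (N p j₀)
        ≈⟨ +-inverseˡ (e * ι (N p j₀)) ⟩
      0ℝ
        ∎

  -- Completeness of the list of eigenvalues.

  -- With μ = 1 + R - R θ and g = C x, the vector g satisfies (K μ - K - P) g = sum g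
  -- and hence (K μ - K - P - W) (sum g) = 0.  As K R = W + P, the two factors are
  -- K R (θ₂ - θ) and - K R θ, while μ = R (θ₁ - θ).
  characteristic : ∀ {θ} → IsLEigenvalue θ →
    (θ + - 0ℝ) * ((θ + - fromℚ θ₁) * (θ + - fromℚ θ₂)) ≃ 0ℝ
  characteristic {θ} (x , (u , xu#0) , Lx) =
    -- Scaling by `x u`, `R` and twice by `Q`, all apart from 0, turns the three factors into β, α
    -- and μ up to sign.
    #0-cancel (ι#0 (k ℕ.* r)) (#0-cancel (ι#0 (k ℕ.* r)) (#0-cancel (ι#0 r) (#0-cancel xu#0 (begin
      x u * (R * (Q * (Q * ((θ + - 0ℝ) * ((θ + - fromℚ θ₁) * (θ + - fromℚ θ₂))))))
        ≈⟨ solve 6 (λ y R Q θ a b → y :* (R :* (Q :* (Q :* ((θ :- con 0ℚ) :* ((θ :- a) :* (θ :- b)))))) :=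
                      :- ((:- (Q :* θ)) :* (Q :* (b :- θ)) :* (R :* (a :- θ)) :* y))
             ≃-refl (x u) R Q θ (fromℚ θ₁) (fromℚ θ₂) ⟩
      - (- (Q * θ) * (Q * (fromℚ θ₂ + - θ)) * (R * (fromℚ θ₁ + - θ)) * x u)
        ≈⟨ neg-cong (*-cong (*-cong (*-cong β≃ α≃) μ≃) ≃-refl) ⟨
      - (β * α * μ * x u)
        ≈⟨ neg-cong βαμx ⟩
      - 0ℝ
        ≈⟨ solve 0 (:- con 0ℚ := con 0ℚ) ≃-refl ⟩
      0ℝ
        ∎))))
    where
    open ≃-Reasoning
    open ℝSolver
    μ = 1ℝ + R + - (R * θ)
    α = K * μ + - (K + P)
    β = K * μ + - (K + P + W)
    g = C x
    Q = ι (k ℕ.* r)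

    μx : ∀ w → μ * x w ≃ Cᵀ g w
    μx w = begin
      (1ℝ + R + - (R * θ)) * x w
        ≈⟨ solve 3 (λ R θ y → (con 1ℚ :+ R :- R :* θ) :* y := (con 1ℚ :+ R) :* y :- R :* (θ :* y)) ≃-refl R θ (x w) ⟩
      (1ℝ + R) * x w + - (R * (θ * x w))
        ≈⟨ +-cong ≃-refl (neg-cong (≃-trans (*-cong ≃-refl (≃-sym (Lx w))) (laplacian≃CᵀC x w))) ⟩
      (1ℝ + R) * x w + - ((1ℝ + R) * x w + - Cᵀ g w)
        ≈⟨ solve 2 (λ s t → s :- (s :- t) := t) ≃-refl ((1ℝ + R) * x w) (Cᵀ g w) ⟩
      Cᵀ g w
        ∎

    Kμg : ∀ p → K * (μ * g p) ≃ (K + P) * g p + sum g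
    Kμg p = begin
      K * (μ * g p)                ≈⟨ *-cong ≃-refl (C-* μ x p) ⟨
      K * C (λ w → μ * x w) p      ≈⟨ *-cong ≃-refl (C-cong μx p) ⟩
      K * C (Cᵀ g) p               ≈⟨ K*CCᵀ g p ⟩
      (K + P) * g p + sum g        ∎

    αg : ∀ p → α * g p ≃ sum g
    αg p = begin
      α * g p
        ≈⟨ solve 4 (λ K μ P y → (K :* μ :- (K :+ P)) :* y := K :* (μ :* y) :- (K :+ P) :* y) ≃-refl K μ P (g p) ⟩
      K * (μ * g p) + - ((K + P) * g p)
        ≈⟨ +-cong (Kμg p) ≃-refl ⟩
      (K + P) * g p + sum g + - ((K + P) * g p)
        ≈⟨ solve 2 (λ s t → s :+ t :- s := t) ≃-refl ((K + P) * g p) (sum g) ⟩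
      sum g
        ∎

    βσ : β * sum g ≃ 0ℝ
    βσ = begin
      β * sum g
        ≈⟨ solve 5 (λ K μ P W s → (K :* μ :- (K :+ P :+ W)) :* s := (K :* μ :- (K :+ P)) :* s :- W :* s) ≃-refl K μ P W (sum g) ⟩
      α * sum g + - (W * sum g)
        -- Summing `αg` over the v points gives `α * sum g ≃ W * sum g`.
        ≈⟨ +-cong (≃-trans (ℝΣ.*-distribˡ-sum α g) (≃-trans (ℝΣ.sum-cong-≋ αg) (sum-const v (sum g)))) ≃-refl ⟩
      W * sum g + - (W * sum g)
        ≈⟨ ℝR.-‿inverseʳ (W * sum g) ⟩
      0ℝ
        ∎

    βαμx : β * α * μ * x u ≃ 0ℝ
    βαμx = begin
      β * α * μ * x u                ≈⟨ *-assoc (β * α) μ (x u) ⟩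
      β * α * (μ * x u)              ≈⟨ *-cong ≃-refl (μx u) ⟩
      β * α * Cᵀ g u                 ≈⟨ Cᵀ-* (β * α) g u ⟨
      Cᵀ (λ p → β * α * g p) u       ≈⟨ Cᵀ-cong (λ p → ≃-trans (*-assoc β α (g p)) (≃-trans (*-cong ≃-refl (αg p))
                                          (≃-trans βσ (≃-sym (ℝR.zeroˡ 0ℝ))))) u ⟩
      Cᵀ (λ _ → 0ℝ * 0ℝ) u           ≈⟨ Cᵀ-* 0ℝ (λ _ → 0ℝ) u ⟩
      0ℝ * Cᵀ (λ _ → 0ℝ) u           ≈⟨ ℝR.zeroˡ _ ⟩
      0ℝ                             ∎

    μ≃ : μ ≃ R * (fromℚ θ₁ + - θ)
    μ≃ = begin
      1ℝ + R + - (R * θ)               ≈⟨ +-cong (+-comm 1ℝ R) ≃-refl ⟩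
      R + 1ℝ + - (R * θ)               ≈⟨ +-cong R*θ₁ ≃-refl ⟨
      R * fromℚ θ₁ + - (R * θ)         ≈⟨ solve 3 (λ R a θ → R :* a :- R :* θ := R :* (a :- θ)) ≃-refl R (fromℚ θ₁) θ ⟩
      R * (fromℚ θ₁ + - θ)             ∎

    α≃ : α ≃ Q * (fromℚ θ₂ + - θ)
    α≃ = begin
      K * (1ℝ + R + - (R * θ)) + - (K + P)
        ≈⟨ solve 4 (λ K R θ P → K :* (con 1ℚ :+ R :- R :* θ) :- (K :+ P) := K :* R :- P :- K :* R :* θ) ≃-refl K R θ P ⟩
      K * R + - P + - (K * R * θ)
        ≈⟨ +-cong (+-cong KR≃W+P ≃-refl) ≃-refl ⟩
      W + P + - P + - (K * R * θ)
        ≈⟨ solve 3 (λ W P s → W :+ P :- P :- s := W :- s) ≃-refl W P (K * R * θ) ⟩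
      W + - (K * R * θ)
        ≈⟨ +-cong KR*θ₂ ≃-refl ⟨
      K * R * fromℚ θ₂ + - (K * R * θ)
        ≈⟨ solve 3 (λ Q b θ → Q :* b :- Q :* θ := Q :* (b :- θ)) ≃-refl (K * R) (fromℚ θ₂) θ ⟩
      K * R * (fromℚ θ₂ + - θ)
        ≈⟨ *-cong (ι-* k r) ≃-refl ⟨
      Q * (fromℚ θ₂ + - θ)
        ∎

    β≃ : β ≃ - (Q * θ)
    β≃ = begin
      K * (1ℝ + R + - (R * θ)) + - (K + P + W)
        ≈⟨ solve 5 (λ K R θ P W → K :* (con 1ℚ :+ R :- R :* θ) :- (K :+ P :+ W) := K :* R :- (W :+ P) :- K :* R :* θ) ≃-refl K R θ P W ⟩
      K * R + - (W + P) + - (K * R * θ)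
        ≈⟨ +-cong (+-cong KR≃W+P ≃-refl) (neg-cong (*-cong (≃-sym (ι-* k r)) ≃-refl)) ⟩
      W + P + - (W + P) + - (Q * θ)
        ≈⟨ solve 2 (λ s t → s :- s :- t := :- t) ≃-refl (W + P) (Q * θ) ⟩
      - (Q * θ)
        ∎

  eigenvalue⇒ : ∀ {θ} → IsLEigenvalue θ → Any (θ ≃_) (0ℝ ∷ fromℚ θ₁ ∷ fromℚ θ₂ ∷ [])
  eigenvalue⇒ {θ} θ-eig = decide (#-cotrans θ 0≢θ₁) (#-cotrans θ 0≢θ₂) (#-cotrans θ θ₁≢θ₂)
    where
    open ℝSolver
    x y z : ℝ
    x = θ + - 0ℝ
    y = θ + - fromℚ θ₁
    z = θ + - fromℚ θ₂
    xyz≃0 : x * (y * z) ≃ 0ℝ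
    xyz≃0 = characteristic θ-eig
    is-0 : θ # fromℚ θ₁ → θ # fromℚ θ₂ → θ ≃ 0ℝ
    is-0 θ#θ₁ θ#θ₂ = -≃0⇒≃ (#0-cancel (#⇒-#0 θ#θ₁) (#0-cancel (#⇒-#0 θ#θ₂)
      (≃-trans (solve 3 (λ x y z → z :* (y :* x) := x :* (y :* z)) ≃-refl x y z) xyz≃0)))
    is-θ₁ : θ # 0ℝ → θ # fromℚ θ₂ → θ ≃ fromℚ θ₁
    is-θ₁ θ#0 θ#θ₂ = -≃0⇒≃ (#0-cancel (#⇒-#0 θ#0) (#0-cancel (#⇒-#0 θ#θ₂)
      (≃-trans (solve 3 (λ x y z → z :* (x :* y) := x :* (y :* z)) ≃-refl x y z) xyz≃0)))
    is-θ₂ : θ # 0ℝ → θ # fromℚ θ₁ → θ ≃ fromℚ θ₂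
    is-θ₂ θ#0 θ#θ₁ = -≃0⇒≃ (#0-cancel (#⇒-#0 θ#θ₁) (#0-cancel (#⇒-#0 θ#0)
      (≃-trans (solve 3 (λ x y z → x :* (y :* z) := x :* (y :* z)) ≃-refl x y z) xyz≃0)))
    decide : θ # 0ℝ ⊎ θ # fromℚ θ₁ → θ # 0ℝ ⊎ θ # fromℚ θ₂ → θ # fromℚ θ₁ ⊎ θ # fromℚ θ₂ →
             Any (θ ≃_) (0ℝ ∷ fromℚ θ₁ ∷ fromℚ θ₂ ∷ [])
    -- Each test separates θ from one member of a pair. No value belongs to all three pairs, so θ is
    -- apart from at least two of the values and equals the third.
    decide (inj₁ θ#0)  _           (inj₁ θ#θ₁) = there (there (here (is-θ₂ θ#0 θ#θ₁)))
    decide (inj₁ θ#0)  _           (inj₂ θ#θ₂) = there (here (is-θ₁ θ#0 θ#θ₂))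
    decide (inj₂ θ#θ₁) (inj₁ θ#0)  _           = there (there (here (is-θ₂ θ#0 θ#θ₁)))
    decide (inj₂ θ#θ₁) (inj₂ θ#θ₂) _           = here (is-0 θ#θ₁ θ#θ₂)

mainTheorem5 : ∀ {v k b : ℕ} (D : Design v k b) → v < b →
    Graph.DistinctLEigenvaluesAre (Γ D)
    (0ℝ ∷ fromℚ (1+1/r D) ∷ fromℚ (1-1/k+1/rk D) ∷ [])
mainTheorem5 D v<b =
  (fromℚ-# 0≢θ₁ ∷ fromℚ-# 0≢θ₂ ∷ []) ∷ (fromℚ-# θ₁≢θ₂ ∷ []) ∷ [] ∷ [] ,
  λ θ → mk⇔ eigenvalue⇒ λ where
    (here θ≃0)                  → 0-eigenvalue θ≃0
    -- The bound `v<b` supplies the block from which the kernel vector of C is built.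
    (there (here θ≃θ₁))         → θ₁-eigenvalue (ℕ.≤-<-trans ℕ.z≤n v<b) θ≃θ₁
    (there (there (here θ≃θ₂))) → θ₂-eigenvalue θ≃θ₂
  where open Spectrum D
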